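{- There is a constant $C$ such that for every sufficiently large $n$ there exists a $1$-planar graph of girth $5$ on $n$ vertices with at least $\left(2+\frac{1}{6}\right)n-C$ edges.
   Context: All graphs are finite and simple. A graph is $k$-planar if it admits a drawing in the plane in which every edge is crossed at most $k$ times. The girth of a graph is the length of its shortest cycle. (The paper states the edge count as $(2+\frac16)n-O(1)$.) -}

module Defs where

open import Data.Bool.Base using (Bool; T)
open import Data.Bool.Properties using (T?)
open import Data.Fin.Base using (Fin; zero; suc; inject₁; fromℕ; _<_)
open import Data.Fin.Properties using (_<?_)
open import Data.Integer.Base using (+_)
open import Data.List.Base using (List; length; filter; allFin; cartesianProduct)
open import Data.Nat.Base as ℕ using (ℕ; suc)
open import Data.Product.Base using (Σ; ∃; ∃₂; _×_; _,_)
open import Data.Rational.Unnormalised.Base as ℚ using (ℚᵘ; 0ℚᵘ; 1ℚᵘ; _/_; ∣_∣)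
import Data.Rational.Unnormalised.Properties as ℚ
open import Function.Definitions using (Injective)
open import Relation.Binary.PropositionalEquality using (_≡_; _≢_)
open import Relation.Nullary using (¬_)
open import Relation.Nullary.Decidable using (_×-dec_)

record Graph (n : ℕ) : Set where
  field
    adj        : Fin n → Fin n → Bool
    adj-sym    : ∀ u v → T (adj u v) → T (adj v u)
    adj-irrefl : ∀ v → ¬ T (adj v v)

  _~_ : Fin n → Fin n → Set
  u ~ v = T (adj u v)

open Graph public using (_~_)

-- An undirected edge is represented by its unique increasing orientation.
record Edge {n} (G : Graph n) : Set where
  constructor edge
  field
    src tgt  : Fin n
    src<tgt  : src < tgt
    adjacent : _~_ G src tgt

open Edge public

edges : ∀ {n} → Graph n → List (Fin n × Fin n)
edges {n} G =
  filter (λ (u , v) → (u <? v) ×-dec T? (Graph.adj G u v))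
         (cartesianProduct (allFin n) (allFin n))

edgeCount : ∀ {n} → Graph n → ℕ
edgeCount G = length (edges G)

record Cycle {n} (G : Graph n) : Set where
  field
    {pred-len} : ℕ

  len : ℕ
  len = suc pred-len

  field
    3≤len    : 3 ℕ.≤ len
    vertex   : Fin len → Fin n
    distinct : Injective _≡_ _≡_ vertex
    step     : ∀ i → _~_ G (vertex (inject₁ i)) (vertex (suc i))
    close    : _~_ G (vertex (fromℕ pred-len)) (vertex zero)

HasGirth : ∀ {n} → Graph n → ℕ → Set
HasGirth G g =
  (Σ (Cycle G) λ c → Cycle.len c ≡ g) × (∀ (c : Cycle G) → g ℕ.≤ Cycle.len c)

-- Real numbers as Bishop's regular sequences: |xₘ − xₙ| ≤ 1/(m+1) + 1/(n+1).

record ℝ : Set where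
  constructor mkℝ
  field
    seq     : ℕ → ℚᵘ
    regular : ∀ m n → ∣ seq m ℚ.- seq n ∣ ℚ.≤ + 1 / suc m ℚ.+ + 1 / suc n

open ℝ public

infix 4 _≈_ _≤_ _≈²_

-- |xₙ − x| ≤ 1/(n+1), so each relation between reals below holds iff it holds
-- between the n-th approximations up to the error 2/(n+1), for every n.

_≈_ : ℝ → ℝ → Set
x ≈ y = ∀ n → ∣ seq x n ℚ.- seq y n ∣ ℚ.≤ + 2 / suc n

_≤_ : ℝ → ℝ → Set
x ≤ y = ∀ n → seq x n ℚ.≤ seq y n ℚ.+ + 2 / suc n

-- |x − y| ≤ ε
Within : ℚᵘ → ℝ → ℝ → Set
Within ε x y = ∀ n → ∣ seq x n ℚ.- seq y n ∣ ℚ.≤ ε ℚ.+ + 2 / suc n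

fromℚ : ℚᵘ → ℝ
fromℚ q = mkℝ (λ _ → q) λ m n →
  ℚ.≤-trans
    (ℚ.≤-reflexive (ℚ.∣-∣-cong (ℚ.+-inverseʳ q)))
    (ℚ.nonNegative⁻¹ (+ 1 / suc m ℚ.+ + 1 / suc n))

0ℝ 1ℝ : ℝ
0ℝ = fromℚ 0ℚᵘ
1ℝ = fromℚ 1ℚᵘ

≤-refl : ∀ x → x ≤ x
≤-refl x n = ℚ.p≤p+q (seq x n) (+ 2 / suc n)

0≤1 : 0ℝ ≤ 1ℝ
0≤1 n = ℚ.nonNegative⁻¹ (1ℚᵘ ℚ.+ + 2 / suc n)

record 𝕀 : Set where
  constructor mk𝕀
  field
    val   : ℝ
    0≤val : 0ℝ ≤ val
    val≤1 : val ≤ 1ℝ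

open 𝕀 public using (val)

0𝕀 1𝕀 : 𝕀
0𝕀 = mk𝕀 0ℝ (≤-refl 0ℝ) 0≤1
1𝕀 = mk𝕀 1ℝ 0≤1 (≤-refl 1ℝ)

ℝ² : Set
ℝ² = ℝ × ℝ

_≈²_ : ℝ² → ℝ² → Set
(x , y) ≈² (x′ , y′) = x ≈ x′ × y ≈ y′

-- Distance at most ε in the maximum metric.
Within² : ℚᵘ → ℝ² → ℝ² → Set
Within² ε (x , y) (x′ , y′) = Within ε x x′ × Within ε y y′

-- Simple (Jordan) arcs.  On the compact interval continuity is uniform
-- continuity; it implies that `at` respects equality of reals.
record Arc : Set where
  field
    at         : 𝕀 → ℝ²
    continuous : ∀ ε → 0ℚᵘ ℚ.< ε → ∃ λ δ → 0ℚᵘ ℚ.< δ ×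
                 (∀ s t → Within δ (val s) (val t) → Within² ε (at s) (at t))
    injective  : ∀ s t → at s ≈² at t → val s ≈ val t

open Arc public using (at)

Interior : 𝕀 → Set
Interior t = ¬ (val t ≈ 0ℝ) × ¬ (val t ≈ 1ℝ)

record Drawing {n} (G : Graph n) : Set where
  field
    point           : Fin n → ℝ²
    point-injective : ∀ u v → point u ≈² point v → u ≡ v
    arc             : Edge G → Arc
    starts          : ∀ e → at (arc e) 0𝕀 ≈² point (src e)
    ends            : ∀ e → at (arc e) 1𝕀 ≈² point (tgt e)
    avoids          : ∀ e w → w ≢ src e → w ≢ tgt e →
                      ∀ t → ¬ (at (arc e) t ≈² point w)

-- A crossing on e: an interior point of e that is also an interior point of
-- another edge.  A point shared by several other edges counts once for each of
-- them, and tangencies count as crossings.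
record Crossing {n} {G : Graph n} (D : Drawing G) (e : Edge G) : Set where
  open Drawing D
  field
    other           : Edge G
    other≢          : other ≢ e
    param           : 𝕀
    param′          : 𝕀
    param-interior  : Interior param
    param′-interior : Interior param′
    meet            : at (arc e) param ≈² at (arc other) param′

-- Arcs are injective, so `param` determines the point and `param′`.
SameCrossing : ∀ {n} {G : Graph n} {D : Drawing G} {e : Edge G} →
               Crossing D e → Crossing D e → Set
SameCrossing c d =
  Crossing.other c ≡ Crossing.other d × val (Crossing.param c) ≈ val (Crossing.param d)

CrossedAtMost : ∀ {n} {G : Graph n} → ℕ → Drawing G → Edge G → Set
CrossedAtMost k D e =
  ∀ (c : Fin (suc k) → Crossing D e) →
  ∃₂ λ i j → i ≢ j × SameCrossing (c i) (c j)

_-Planar : ∀ {n} → ℕ → Graph n → Set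
(k -Planar) G = Σ (Drawing G) λ D → ∀ e → CrossedAtMost k D e

{-# OPTIONS --safe #-}
module Submission where

-- The vertices are the natural numbers, in cells of six, and G_n is induced on
-- {0, …, n − 1}.  The graph is a doubly periodic straight-line drawing with 6
-- vertices and 13 edges per cell, wound around the origin as a logarithmic
-- spiral: passing to the next cell is multiplication by 1 + i.  The open end of
-- the spiral meets only boundedly many edges, so the loss is a constant.
--
-- Multiplication by 1 + i doubles scalar products, so every claim that a line
-- separates two edges is invariant under the shift by one cell and has to be
-- checked for finitely many pairs of nearby edges only.  For distant pairs, the
-- outer edge recedes by the factor (1 + i)⁸ = 16 every eight cells while the
-- inner one stays behind the same line.

-- A finite patch of a doubly periodic drawing in the plane loses edges along a boundary of order
-- √n. Winding the pattern leaves a single chain of cells, which can be cut after any vertex at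
-- bounded cost. The winding does not preserve straight lines, so the straight drawing is not
-- inherited from the flat pattern and all incidences have to be verified anew. The arcs take
-- arbitrary Bishop reals as parameters, and the order of reals is undecidable. Hence the geometry
-- rests on certificates: a linear form with integer coefficients and a level. Such a certificate
-- turns a common point of two segments into a nonnegative combination of rational sequences, which
-- either has a negative sum or forces a parameter to 0 or 1.

open import Defs
open import Data.Bool.Properties using (T-irrelevant)
open import Data.Fin using (#_)
open import Data.Fin.Base as Fin using (Fin; zero; suc; toℕ; fromℕ<; _↑ˡ_)
import Data.Fin.Properties as Fin
open import Data.Integer.Base as ℤ using (ℤ; +_; -[1+_])
import Data.Integer.Properties as ℤ
open import Data.Integer.Solver using () renaming (module +-*-Solver to ℤSolver)
open import Data.List.Base using (List; []; _∷_; _++_; map; length)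
open import Data.List.Membership.Propositional using (_∈_)
open import Data.List.Membership.Propositional.Properties
  using (∈-∃++; ∈-++⁻; ∈-++⁺ˡ; ∈-++⁺ʳ; ∈-map⁺; ∈-map⁻; ∈-filter⁺; ∈-cartesianProduct⁺; ∈-allFin)
open import Data.List.Properties using (length-++; length-map)
open import Data.List.Relation.Binary.Subset.Propositional using (_⊆_)
open import Data.List.Relation.Unary.All as All using (All; all?)
open import Data.List.Relation.Unary.AllPairs using ([]; _∷_)
open import Data.List.Relation.Unary.Any using (here; there)
open import Data.List.Relation.Unary.Unique.Propositional using (Unique)
open import Data.List.Relation.Unary.Unique.Propositional.Properties using (map⁺; ++⁺)
open import Data.Nat.Base as ℕ using (ℕ; zero; suc; _∸_; NonZero; z≤n; s≤s)
open import Data.Nat.Induction using (<-rec)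
import Data.Nat.Properties as ℕ
open import Data.Nat.Solver using () renaming (module +-*-Solver to ℕSolver)
open import Data.Product.Base using (Σ; ∃; _×_; _,_; proj₁; proj₂)
open import Data.Product.Properties using (≡-dec)
open import Data.Rational.Unnormalised.Base as ℚ
  using (ℚᵘ; mkℚᵘ; 0ℚᵘ; 1ℚᵘ; _/_; _+_; _*_; _-_; -_; ∣_∣; _≃_; *≡*; *≤*)
import Data.Rational.Unnormalised.Properties as ℚ
open import Data.Rational.Unnormalised.Solver using () renaming (module +-*-Solver to ℚSolver)
open import Data.Sum.Base as Sum using (_⊎_; inj₁; inj₂; [_,_]′)
open import Data.Vec.Base using ([]; _∷_; lookup)
open import Function.Base using (_∘_)
open import Relation.Binary.Definitions using (tri<; tri≈; tri>)
open import Relation.Binary.PropositionalEquality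
  using (_≡_; _≢_; refl; sym; trans; cong; cong₂; subst; subst₂; module ≡-Reasoning)
open import Relation.Nullary using (¬_; contradiction; Dec; yes; no)
open import Relation.Nullary.Decidable using (_×-dec_; _⊎-dec_; _→-dec_; ¬?; toWitness; fromWitness; ⌊_⌋)

open import Data.List.Membership.DecPropositional ℕ._≟_ using (_∈?_)
open import Data.List.Membership.DecPropositional (≡-dec ℕ._≟_ (≡-dec ℕ._≟_ ℕ._≟_))
  using () renaming (_∈?_ to _∈³?_)
open import Data.List.Relation.Unary.Unique.DecPropositional ℕ._≟_ using (unique?)

-- Rational sequences and their limits

ι : ℤ → ℚᵘ
ι z = z / 1

ι-+ : ∀ a b → ι (a ℤ.+ b) ≃ ι a + ι b
ι-+ a b = *≡* (solve 2 (λ a b → (a :+ b) :* con (+ 1) := (a :* con (+ 1) :+ b :* con (+ 1)) :* con (+ 1)) refl a b)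
  where open ℤSolver

ι-- : ∀ a b → ι (a ℤ.- b) ≃ ι a - ι b
ι-- a b = ι-+ a (ℤ.- b)

ι-* : ∀ a b → ι (a ℤ.* b) ≃ ι a * ι b
ι-* a b = *≡* refl

-- lim inf f ≥ 0 with rate C/n.  Nonnegative integer combinations preserve this,
-- so inequalities between reals reduce to linear identities in ℚ.
record Lim≥0 (f : ℕ → ℚᵘ) : Set where
  constructor lim
  field
    rate  : ℕ
    bound : ∀ n → 0ℚᵘ ℚ.≤ f n + + rate / suc n

lim-cong : ∀ {f g} → (∀ n → f n ≃ g n) → Lim≥0 f → Lim≥0 g
lim-cong eq (lim C p) = lim C λ n → ℚ.≤-respʳ-≃ (ℚ.+-congˡ (+ C / suc n) (eq n)) (p n)

/-+ : ∀ C D n → + C / suc n + + D / suc n ≃ + (C ℕ.+ D) / suc n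
/-+ C D n = *≡* (solve 3 (λ c d k → (c :* k :+ d :* k) :* k := (c :+ d) :* (k :* k)) refl (+ C) (+ D) (+ suc n))
  where open ℤSolver

lim-+ : ∀ {f g} → Lim≥0 f → Lim≥0 g → Lim≥0 (λ n → f n + g n)
lim-+ {f} {g} (lim C p) (lim D q) = lim (C ℕ.+ D) λ n → ℚ.≤-respʳ-≃
  (ℚ.≃-trans
    (solve 4 (λ a b c d → (a :+ c) :+ (b :+ d) := (a :+ b) :+ (c :+ d)) ℚ.≃-refl (f n) (g n) (+ C / suc n) (+ D / suc n))
    (ℚ.+-congʳ (f n + g n) (/-+ C D n)))
  (ℚ.+-mono-≤ (p n) (q n))
  where open ℚSolver

lim-* : ∀ k {f} → Lim≥0 f → Lim≥0 (λ n → ι (+ k) * f n)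
lim-* k {f} (lim C p) = lim (k ℕ.* C) λ n → ℚ.≤-respʳ-≃
  (ℚ.≃-trans (ℚ.*-distribˡ-+ (ι (+ k)) (f n) (+ C / suc n))
    (ℚ.+-congʳ (ι (+ k) * f n) (scale n)))
  (ℚ.≤-respˡ-≃ (ℚ.*-zeroʳ (ι (+ k))) (ℚ.*-monoʳ-≤-nonNeg (ι (+ k)) (p n)))
  where
  scale : ∀ n → ι (+ k) * (+ C / suc n) ≃ + (k ℕ.* C) / suc n
  scale n = *≡* (trans (cong (ℤ._* + suc n) (sym (ℤ.pos-* k C)))
    (cong (λ m → + (k ℕ.* C) ℤ.* + m) (sym (ℕ.+-identityʳ (suc n)))))

lim-*-0≤ : ∀ {z f} → + 0 ℤ.≤ z → Lim≥0 f → Lim≥0 (λ n → ι z * f n)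
lim-*-0≤ {+ k} _ = lim-* k

lim-*-ℤ : ∀ z {f} → Lim≥0 f → Lim≥0 (λ n → - f n) → Lim≥0 (λ n → ι z * f n)
lim-*-ℤ (+ k) p _ = lim-* k p
lim-*-ℤ -[1+ k ] {f} _ q = lim-cong
  (λ n → solve 2 (λ a b → a :* :- b := (:- a) :* b) ℚ.≃-refl (ι (+ suc k)) (f n))
  (lim-* (suc k) q)
  where open ℚSolver

-- As z is an integer, z ≥ 1 and C/n ≤ zC/n, so division by z can keep the rate.
lim-cancel : ∀ {z f} → + 0 ℤ.< z → Lim≥0 (λ n → ι z * f n) → Lim≥0 f
lim-cancel {+ suc k} {f} _ (lim C p) = lim C λ n → ℚ.*-cancelˡ-≤-pos K
  (ℚ.≤-respˡ-≃ (ℚ.≃-sym (ℚ.*-zeroʳ K))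
  (ℚ.≤-trans (p n)
  (ℚ.≤-respʳ-≃ (ℚ.≃-sym (ℚ.*-distribˡ-+ K (f n) (+ C / suc n)))
  (ℚ.+-monoʳ-≤ (K * f n) (bound n)))))
  where
  K = ι (+ suc k)
  bound : ∀ n → + C / suc n ℚ.≤ K * (+ C / suc n)
  bound n = ℚ.≤-respˡ-≃ (ℚ.*-identityˡ (+ C / suc n))
    (ℚ.*-monoˡ-≤-nonNeg (+ C / suc n) {1ℚᵘ} {K} (*≤* (ℤ.+≤+ (ℕ.s≤s ℕ.z≤n))))
lim-cancel {+ zero} (ℤ.+<+ ())

lim-const : ∀ {q} → Lim≥0 (λ _ → q) → 0ℚᵘ ℚ.≤ q
lim-const {mkℚᵘ (+ a) b} _ = ℚ.nonNegative⁻¹ (mkℚᵘ (+ a) b)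
-- At this index the error is C/(C(b+1)+1) < 1/(b+1), too small to lift -(a+1)/(b+1) to 0.
lim-const {mkℚᵘ -[1+ a ] b} (lim C p) = contradiction (p (C ℕ.* suc b)) bad
  where
  N = suc (C ℕ.* suc b)

  eq : ∀ x n y → ((ℤ.- x) ℤ.* n ℤ.+ y) ℤ.* + 1 ≡ y ℤ.- x ℤ.* n
  eq = solve 3 (λ x n y → ((:- x) :* n :+ y) :* con (+ 1) := y :- x :* n) refl
    where open ℤSolver

  bad : ¬ (0ℚᵘ ℚ.≤ mkℚᵘ -[1+ a ] b + + C / N)
  bad (*≤* le) = ℕ.1+n≰n (ℕ.≤-trans (ℕ.m≤m+n N (a ℕ.* N)) (ℤ.drop‿+≤+
    (subst (+ (suc a ℕ.* N) ℤ.≤_) (sym (ℤ.pos-* C (suc b)))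
      (ℤ.0≤i-j⇒j≤i (subst (+ 0 ℤ.≤_) (eq (+ suc a) (+ N) (+ C ℤ.* + suc b)) le)))))

neg-sub : ∀ a b → - (a - b) ≃ b - a
neg-sub = solve 2 (λ a b → :- (a :- b) := b :- a) ℚ.≃-refl
  where open ℚSolver

Vanishes : (ℕ → ℚᵘ) → Set
Vanishes f = Lim≥0 f × Lim≥0 (λ n → - f n)

vanishes-cong : ∀ {f g} → (∀ n → f n ≃ g n) → Vanishes f → Vanishes g
vanishes-cong eq (p , q) = lim-cong eq p , lim-cong (λ n → ℚ.-‿cong (eq n)) q

vanishes-neg : ∀ {f} → Vanishes f → Vanishes (λ n → - f n)
vanishes-neg {f} (p , q) = q , lim-cong (λ n → ℚ.≃-sym (ℚ.neg-involutive (f n))) p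

vanishes-+ : ∀ {f g} → Vanishes f → Vanishes g → Vanishes (λ n → f n + g n)
vanishes-+ {f} {g} (p , q) (p′ , q′) = lim-+ p p′ ,
  lim-cong (λ n → ℚ.≃-reflexive (sym (ℚ.neg-distrib-+ (f n) (g n)))) (lim-+ q q′)

vanishes-* : ∀ z {f} → Vanishes f → Vanishes (λ n → ι z * f n)
vanishes-* z {f} (p , q) = lim-*-ℤ z p q ,
  lim-cong (λ n → ℚ.≃-sym (ℚ.neg-distribʳ-* (ι z) (f n)))
    (lim-*-ℤ z q (proj₂ (vanishes-neg (p , q))))

∣p∣≤q : ∀ {p q} → p ℚ.≤ q → - p ℚ.≤ q → ∣ p ∣ ℚ.≤ q
∣p∣≤q {p} {q} a b with ℚ.∣p∣≡p∨∣p∣≡-p p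
... | inj₁ e = subst (ℚ._≤ q) (sym e) a
... | inj₂ e = subst (ℚ._≤ q) (sym e) b

p≤∣p∣ : ∀ p → p ℚ.≤ ∣ p ∣
p≤∣p∣ (mkℚᵘ (+ a) b) = ℚ.≤-refl
p≤∣p∣ (mkℚᵘ -[1+ a ] b) = *≤* ℤ.-≤+

1/suc-anti : ∀ {m n} → m ℕ.≤ n → + 1 / suc n ℚ.≤ + 1 / suc m
1/suc-anti m≤n = *≤* (ℤ.+≤+ (ℕ.s≤s (ℕ.+-monoˡ-≤ 0 m≤n)))

lim-∣∣ : ∀ (f : ℕ → ℚᵘ) q C → (∀ n → ∣ f n ∣ ℚ.≤ q + + C / suc n) → Lim≥0 (λ n → q - f n)
lim-∣∣ f q C p = lim C λ n → ℚ.≤-respʳ-≃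
  (solve 3 (λ f q c → (q :+ c) :- f := (q :- f) :+ c) ℚ.≃-refl (f n) q (+ C / suc n))
  (ℚ.p≤q⇒0≤q-p (ℚ.≤-trans (p≤∣p∣ (f n)) (p n)))
  where open ℚSolver

module _ {i : ℕ → ℕ} (n≤i : ∀ n → n ℕ.≤ i n) where

  private
    regular-lim : ∀ x m → Lim≥0 (λ n → + 1 / suc m - (seq x m - seq x (i n)))
    regular-lim x m = lim-∣∣ (λ n → seq x m - seq x (i n)) (+ 1 / suc m) 1 λ n →
      ℚ.≤-trans (regular x m (i n)) (ℚ.+-monoʳ-≤ (+ 1 / suc m) (1/suc-anti (n≤i n)))

    regular-lim′ : ∀ x m → Lim≥0 (λ n → + 1 / suc m - (seq x (i n) - seq x m))
    regular-lim′ x m = lim-∣∣ (λ n → seq x (i n) - seq x m) (+ 1 / suc m) 1 λ n →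
      ℚ.≤-trans (regular x (i n) m)
        (ℚ.≤-trans (ℚ.+-monoˡ-≤ (+ 1 / suc m) (1/suc-anti (n≤i n)))
          (ℚ.≤-reflexive (ℚ.+-comm (+ 1 / suc n) (+ 1 / suc m))))

    lim-≤ : ∀ x y → Lim≥0 (λ n → seq y (i n) - seq x (i n)) →
            ∀ m → seq x m - seq y m ℚ.≤ + 2 / suc m
    lim-≤ x y p m = ℚ.0≤q-p⇒p≤q (lim-const (lim-cong
      (λ n → ℚ.≃-trans
        (solve 5 (λ e x x′ y y′ →
            (e :- (x :- x′) :+ (y′ :- x′)) :+ (e :- (y′ :- y)) := (e :+ e) :- (x :- y))
          ℚ.≃-refl (+ 1 / suc m) (seq x m) (seq x (i n)) (seq y m) (seq y (i n)))
        (ℚ.+-congˡ (- (seq x m - seq y m)) (/-+ 1 1 m)))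
      (lim-+ (lim-+ (regular-lim x m) p) (regular-lim′ y m))))
      where open ℚSolver

  -- Regularity compares entry m of each real with its entries i n at cost 1/(m+1). Letting n grow
  -- removes the unknown rate and leaves exactly the 2/(m+1) that `_≈_` demands. The reindexing i
  -- allows for samples taken at a higher precision.
  vanishes⇒≈ : ∀ x y → Vanishes (λ n → seq x (i n) - seq y (i n)) → x ≈ y
  vanishes⇒≈ x y (p , q) m = ∣p∣≤q
    (lim-≤ x y (lim-cong (λ n → neg-sub (seq x (i n)) (seq y (i n))) q) m)
    (ℚ.≤-trans (ℚ.≤-reflexive (neg-sub (seq x m) (seq y m))) (lim-≤ y x p m))

≈⇒vanishes : ∀ {x y} → x ≈ y → Vanishes (λ n → seq x n - seq y n)
≈⇒vanishes {x} {y} p =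
  lim-cong (λ n → ℚ.≃-trans (ℚ.+-identityˡ _) (neg-sub (seq y n) (seq x n)))
    (lim-∣∣ (λ n → seq y n - seq x n) 0ℚᵘ 2 λ n → bound n (ℚ.≤-trans
      (ℚ.≤-reflexive (ℚ.≃-trans (ℚ.∣-∣-cong (ℚ.≃-sym (neg-sub (seq x n) (seq y n))))
        (ℚ.∣-p∣≃∣p∣ (seq x n - seq y n))))
      (p n))) ,
  lim-cong (λ n → ℚ.+-identityˡ _)
    (lim-∣∣ (λ n → seq x n - seq y n) 0ℚᵘ 2 λ n → bound n (p n))
  where
  bound : ∀ n {q} → q ℚ.≤ + 2 / suc n → q ℚ.≤ 0ℚᵘ + + 2 / suc n
  bound n = ℚ.≤-respʳ-≃ (ℚ.≃-sym (ℚ.+-identityˡ (+ 2 / suc n)))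

-- Points on an interval and separating levels

between : ℤ → ℤ → ℚᵘ → ℚᵘ
between p q t = ι p + t * (ι q - ι p)

InUnit : (ℕ → ℚᵘ) → Set
InUnit σ = Lim≥0 σ × Lim≥0 (λ n → 1ℚᵘ - σ n)

-- If p, q ≤ h ≤ r, s, then (h − p)(1 − σ) + (h − q)σ + (r − h)(1 − τ) + (s − h)τ
-- is the difference of the two points, so where they meet every summand vanishes.
module _ {p q r s h : ℤ} {σ τ : ℕ → ℚᵘ} (σ∈ : InUnit σ) (τ∈ : InUnit τ)
         (meet : Vanishes (λ n → between p q (σ n) - between r s (τ n)))
         (p≤h : p ℤ.≤ h) (q≤h : q ℤ.≤ h) where

  private
    sub : ∀ {a b f} → a ℤ.≤ b → Lim≥0 f → Lim≥0 (λ n → (ι b - ι a) * f n)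
    sub {a} {b} {f} a≤b l = lim-cong (λ n → ℚ.*-congʳ {f n} (ι-- b a)) (lim-*-0≤ (ℤ.i≤j⇒0≤j-i a≤b) l)

    sub< : ∀ {a b f} → a ℤ.< b → Lim≥0 f → Lim≥0 (λ n → (ι b - (1ℚᵘ + ι a)) * f n)
    sub< {a} {b} {f} a<b l = lim-cong
      (λ n → ℚ.*-congʳ {f n} (ℚ.≃-trans (ι-- b (ℤ.suc a)) (ℚ.+-congʳ (ι b) (ℚ.-‿cong (ι-+ (+ 1) a)))))
      (lim-*-0≤ (ℤ.i≤j⇒0≤j-i (ℤ.i<j⇒suc[i]≤j a<b)) l)

  -- By integrality s ≥ h + 1. One unit of the coefficient s - h of τ is withheld from the sum, so
  -- the identity leaves -τ instead of 0.
  lim-τ≤0 : h ℤ.≤ r → h ℤ.< s → Lim≥0 (λ n → - τ n)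
  lim-τ≤0 h≤r h<s = lim-cong
    (λ n → solve 7 (λ p q r s h σ τ →
        ((((p :+ σ :* (q :- p)) :- (r :+ τ :* (s :- r)) :+ (h :- p) :* (con 1ℚᵘ :- σ)) :+ (h :- q) :* σ)
          :+ (r :- h) :* (con 1ℚᵘ :- τ)) :+ (s :- (con 1ℚᵘ :+ h)) :* τ := :- τ)
      ℚ.≃-refl (ι p) (ι q) (ι r) (ι s) (ι h) (σ n) (τ n))
    (lim-+ (lim-+ (lim-+ (lim-+ (proj₁ meet) (sub p≤h (proj₂ σ∈))) (sub q≤h (proj₁ σ∈)))
      (sub h≤r (proj₂ τ∈))) (sub< h<s (proj₁ τ∈)))
    where open ℚSolver

  lim-τ≥1 : h ℤ.< r → h ℤ.≤ s → Lim≥0 (λ n → τ n - 1ℚᵘ)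
  lim-τ≥1 h<r h≤s = lim-cong
    (λ n → solve 7 (λ p q r s h σ τ →
        ((((p :+ σ :* (q :- p)) :- (r :+ τ :* (s :- r)) :+ (h :- p) :* (con 1ℚᵘ :- σ)) :+ (h :- q) :* σ)
          :+ (r :- (con 1ℚᵘ :+ h)) :* (con 1ℚᵘ :- τ)) :+ (s :- h) :* τ := τ :- con 1ℚᵘ)
      ℚ.≃-refl (ι p) (ι q) (ι r) (ι s) (ι h) (σ n) (τ n))
    (lim-+ (lim-+ (lim-+ (lim-+ (proj₁ meet) (sub p≤h (proj₂ σ∈))) (sub q≤h (proj₁ σ∈)))
      (sub< h<r (proj₂ τ∈))) (sub h≤s (proj₁ τ∈)))
    where open ℚSolver

-- Segments between integer points

ℤ² : Set
ℤ² = ℤ × ℤ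

infix 8 _·_
_·_ : ℤ² → ℤ² → ℤ
(a , b) · (x , y) = a ℤ.* x ℤ.+ b ℤ.* y

-- The line may contain one end of RS, so edges with a common end are covered.
record Touching (P Q R S : ℤ²) : Set where
  constructor touching
  field
    normal : ℤ²
    level  : ℤ
    P≤     : normal · P ℤ.≤ level
    Q≤     : normal · Q ℤ.≤ level
    ≤R     : level ℤ.≤ normal · R
    ≤S     : level ℤ.≤ normal · S
    strict : level ℤ.< normal · R ⊎ level ℤ.< normal · S

-- The cases P = Q and R = S are meant too: a vertex is a degenerate segment, so one notion serves
-- edges and vertices alike. The weak side lets the line run through P and Q.
record Separated (P Q R S : ℤ²) : Set where
  constructor separated
  field
    normal : ℤ²
    level  : ℤ
    P≤     : normal · P ℤ.≤ level
    Q≤     : normal · Q ℤ.≤ level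
    <R     : level ℤ.< normal · R
    <S     : level ℤ.< normal · S

-- The line through R and S is a level line of the form, and PQ climbs through the levels, hence
-- hits that line at one parameter only.
record Transversal (P Q R S : ℤ²) : Set where
  constructor transversal
  field
    normal : ℤ²
    P<Q    : normal · P ℤ.< normal · Q
    R≡S    : normal · R ≡ normal · S

-- Only limits are compared, so σ and τ may sample their real parameters at different precisions.
record Meet (P Q R S : ℤ²) (σ τ : ℕ → ℚᵘ) : Set where
  constructor meets
  field
    inˣ : Vanishes (λ n → between (proj₁ P) (proj₁ Q) (σ n) - between (proj₁ R) (proj₁ S) (τ n))
    inʸ : Vanishes (λ n → between (proj₂ P) (proj₂ Q) (σ n) - between (proj₂ R) (proj₂ S) (τ n))

vanishes-sym : ∀ {f g : ℕ → ℚᵘ} → Vanishes (λ n → f n - g n) → Vanishes (λ n → g n - f n)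
vanishes-sym {f} {g} v = vanishes-cong (λ n → neg-sub (f n) (g n)) (vanishes-neg v)

meet-sym : ∀ {P Q R S σ τ} → Meet P Q R S σ τ → Meet R S P Q τ σ
meet-sym {P} {Q} {R} {S} {σ} {τ} (meets x y) = meets
  (vanishes-sym {λ n → between (proj₁ P) (proj₁ Q) (σ n)} {λ n → between (proj₁ R) (proj₁ S) (τ n)} x)
  (vanishes-sym {λ n → between (proj₂ P) (proj₂ Q) (σ n)} {λ n → between (proj₂ R) (proj₂ S) (τ n)} y)

ι-· : ∀ a b x y → ι ((a , b) · (x , y)) ≃ ι a * ι x + ι b * ι y
ι-· a b x y = ℚ.≃-trans (ι-+ (a ℤ.* x) (b ℤ.* y)) (ℚ.+-cong (ι-* a x) (ι-* b y))

between-cong : ∀ {p q p′ q′} t → ι p ≃ p′ → ι q ≃ q′ → between p q t ≃ p′ + t * (q′ - p′)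
between-cong t ep eq = ℚ.+-cong ep (ℚ.*-congˡ {t} (ℚ.+-cong eq (ℚ.-‿cong ep)))

meet-· : ∀ {P Q R S σ τ} ℓ → Meet P Q R S σ τ →
         Vanishes (λ n → between (ℓ · P) (ℓ · Q) (σ n) - between (ℓ · R) (ℓ · S) (τ n))
meet-· {P@(px , py)} {Q@(qx , qy)} {R@(rx , ry)} {S@(sx , sy)} {σ} {τ} ℓ@(a , b) (meets x y) =
  vanishes-cong (λ n → ℚ.≃-sym (eq (σ n) (τ n))) (vanishes-+ (vanishes-* a x) (vanishes-* b y))
  where
  open ℚSolver
  proj : ∀ {px py qx qy} t → between (ℓ · (px , py)) (ℓ · (qx , qy)) t ≃
                             ι a * between px qx t + ι b * between py qy t
  proj {px} {py} {qx} {qy} t = ℚ.≃-trans (between-cong t (ι-· a b px py) (ι-· a b qx qy))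
    (solve 7 (λ a b px py qx qy t →
        (a :* px :+ b :* py) :+ t :* ((a :* qx :+ b :* qy) :- (a :* px :+ b :* py)) :=
        a :* (px :+ t :* (qx :- px)) :+ b :* (py :+ t :* (qy :- py)))
      ℚ.≃-refl (ι a) (ι b) (ι px) (ι py) (ι qx) (ι qy) t)
  eq : ∀ s t → between (ℓ · P) (ℓ · Q) s - between (ℓ · R) (ℓ · S) t ≃
               ι a * (between px qx s - between rx sx t) + ι b * (between py qy s - between ry sy t)
  eq s t = ℚ.≃-trans (ℚ.+-cong (proj s) (ℚ.-‿cong (proj t)))
    (solve 6 (λ a b u v u′ v′ → (a :* u :+ b :* v) :- (a :* u′ :+ b :* v′) := a :* (u :- u′) :+ b :* (v :- v′))
      ℚ.≃-refl (ι a) (ι b) (between px qx s) (between py qy s) (between rx sx t) (between ry sy t))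

-- The end of RS strictly beyond the line must carry weight 0 in the limit, so the common point is
-- the opposite end. A crossing in the interior is thereby excluded.
touching⇒end : ∀ {P Q R S σ τ} → Touching P Q R S → InUnit σ → InUnit τ → Meet P Q R S σ τ →
               Vanishes τ ⊎ Vanishes (λ n → τ n - 1ℚᵘ)
touching⇒end {P} {Q} {R} {S} {σ} {τ} (touching ℓ h P≤ Q≤ ≤R ≤S strict) σ∈ τ∈ m = [ atR , atS ]′ strict
  where
  v = meet-· ℓ m
  atR : h ℤ.< ℓ · R → _
  atR <R = inj₂ (lim-τ≥1 {σ = σ} {τ} σ∈ τ∈ v P≤ Q≤ <R ≤S , lim-cong
    (λ n → solve 1 (λ t → con 1ℚᵘ :- t := :- (t :- con 1ℚᵘ)) ℚ.≃-refl (τ n)) (proj₂ τ∈))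
    where open ℚSolver
  atS : h ℤ.< ℓ · S → _
  atS <S = inj₁ (proj₁ τ∈ , lim-τ≤0 {σ = σ} {τ} σ∈ τ∈ v P≤ Q≤ ≤R <S)

-- With both ends strictly beyond the line, τ would be at least 1 and at most 0 in the limit.
separated⇒¬meet : ∀ {P Q R S σ τ} → Separated P Q R S → InUnit σ → InUnit τ → ¬ Meet P Q R S σ τ
separated⇒¬meet {P} {Q} {R} {S} {σ} {τ} (separated ℓ h P≤ Q≤ <R <S) σ∈ τ∈ m =
  contradiction (lim-const (lim-cong
    (λ n → solve 1 (λ t → (t :- con 1ℚᵘ) :+ :- t := con (- 1ℚᵘ)) ℚ.≃-refl (τ n))
    (lim-+ (lim-τ≥1 {σ = σ} {τ} σ∈ τ∈ v P≤ Q≤ <R (ℤ.<⇒≤ <S)) (lim-τ≤0 {σ = σ} {τ} σ∈ τ∈ v P≤ Q≤ (ℤ.<⇒≤ <R) <S))))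
    λ { (*≤* ()) }
  where
  open ℚSolver
  v = meet-· ℓ m

vanishes-cancel : ∀ {z f} → + 0 ℤ.< z → Vanishes (λ n → ι z * f n) → Vanishes f
vanishes-cancel {z} {f} 0<z (p , q) = lim-cancel 0<z p ,
  lim-cancel 0<z (lim-cong (λ n → ℚ.neg-distribʳ-* (ι z) (f n)) q)

between-injective : ∀ {p q} {σ σ′ : ℕ → ℚᵘ} → p ℤ.< q → Vanishes (λ n → between p q (σ n) - between p q (σ′ n)) →
                    Vanishes (λ n → σ n - σ′ n)
between-injective {p} {q} {σ} {σ′} p<q v = vanishes-cancel {f = λ n → σ n - σ′ n}
  (subst (ℤ._< q ℤ.- p) (ℤ.+-inverseʳ p) (ℤ.+-monoˡ-< (ℤ.- p) p<q)) (vanishes-cong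
  (λ n → ℚ.≃-trans
    (solve 4 (λ p q s t → (p :+ s :* (q :- p)) :- (p :+ t :* (q :- p)) := (q :- p) :* (s :- t))
      ℚ.≃-refl (ι p) (ι q) (σ n) (σ′ n))
    (ℚ.*-congʳ {σ n - σ′ n} (ℚ.≃-sym (ι-- q p)))) v)
  where open ℚSolver

-- The form collapses RS to a single value, whatever τ and τ′ are, and it is injective along PQ.
transversal⇒unique : ∀ {P Q R S σ τ σ′ τ′} → Transversal P Q R S →
  Meet P Q R S σ τ → Meet P Q R S σ′ τ′ → Vanishes (λ n → σ n - σ′ n)
transversal⇒unique {P} {Q} {R} {S} {σ} {τ} {σ′} {τ′} (transversal ℓ P<Q R≡S) m m′ =
  between-injective {ℓ · P} {ℓ · Q} {σ} {σ′} P<Q (vanishes-cong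
    (λ n → solve 5 (λ u v r τ τ′ →
        (u :- (r :+ τ :* (r :- r))) :+ :- (v :- (r :+ τ′ :* (r :- r))) := u :- v)
      ℚ.≃-refl (between (ℓ · P) (ℓ · Q) (σ n)) (between (ℓ · P) (ℓ · Q) (σ′ n)) (ι (ℓ · R)) (τ n) (τ′ n))
    (vanishes-+ (flat m) (vanishes-neg (flat m′))))
  where
  open ℚSolver
  flat : ∀ {σ τ} → Meet P Q R S σ τ →
         Vanishes (λ n → between (ℓ · P) (ℓ · Q) (σ n) - between (ℓ · R) (ℓ · R) (τ n))
  flat {σ} {τ} m = subst (λ z → Vanishes (λ n → between (ℓ · P) (ℓ · Q) (σ n) - between (ℓ · R) z (τ n)))
    (sym R≡S) (meet-· ℓ m)

-- Multiplying by a slope of size at most K costs a factor K in precision.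
refine : ℕ → ℕ → ℕ
refine K n = n ℕ.+ K ℕ.* suc n

n≤refine : ∀ K n → n ℕ.≤ refine K n
n≤refine K n = ℕ.m≤m+n n (K ℕ.* suc n)

-- `suc (refine K n)` equals (1 + K)(n + 1), which absorbs the factor K.
refine-* : ∀ K k n → + k / suc (refine K n) * ι (+ K) ℚ.≤ + k / suc n
refine-* K k n = *≤* (subst₂ ℤ._≤_ lhs rhs (ℤ.+≤+ le))
  where
  lhs : + (k ℕ.* K ℕ.* suc n) ≡ + k ℤ.* + K ℤ.* + suc n
  lhs = trans (ℤ.pos-* (k ℕ.* K) (suc n)) (cong (ℤ._* + suc n) (ℤ.pos-* k K))
  rhs : + (k ℕ.* (suc (refine K n) ℕ.* 1)) ≡ + k ℤ.* + (suc (refine K n) ℕ.* 1)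
  rhs = ℤ.pos-* k (suc (refine K n) ℕ.* 1)
  le : k ℕ.* K ℕ.* suc n ℕ.≤ k ℕ.* (suc (refine K n) ℕ.* 1)
  le = subst₂ ℕ._≤_ (sym (ℕ.*-assoc k K (suc n))) (cong (k ℕ.*_) (sym (ℕ.*-identityʳ (suc (refine K n)))))
    (ℕ.*-monoʳ-≤ k (ℕ.m≤n+m (K ℕ.* suc n) (suc n)))

-- Segments as continuous injective arcs

record Bounded (K : ℕ) (a b : ℤ) : Set where
  constructor mkBounded
  field slope≤ : ∣ ι b - ι a ∣ ℚ.≤ ι (+ K)

module _ {K a b} (slope : Bounded K a b) where

  between-lipschitz : ∀ s t {q} → ∣ s - t ∣ ℚ.≤ q → ∣ between a b s - between a b t ∣ ℚ.≤ q * ι (+ K)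
  between-lipschitz s t {q} s-t≤q = begin
    ∣ between a b s - between a b t ∣   ≃⟨ ℚ.∣-∣-cong (solve 4 (λ a b s t →
        (a :+ s :* (b :- a)) :- (a :+ t :* (b :- a)) := (s :- t) :* (b :- a)) ℚ.≃-refl (ι a) (ι b) s t) ⟩
    ∣ (s - t) * (ι b - ι a) ∣           ≃⟨ ℚ.∣p*q∣≃∣p∣*∣q∣ (s - t) (ι b - ι a) ⟩
    ∣ s - t ∣ * ∣ ι b - ι a ∣           ≤⟨ ℚ.*-mono-≤-nonNeg
        {{ℚ.∣-∣-nonNeg (s - t)}} {{ℚ.∣-∣-nonNeg (ι b - ι a)}} s-t≤q (Bounded.slope≤ slope) ⟩
    q * ι (+ K)                         ∎
    where
    open ℚ.≤-Reasoning
    open ℚSolver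

  affine : ℝ → ℝ
  affine t = mkℝ (λ n → between a b (seq t (refine K n))) λ m n → begin
    ∣ between a b (seq t (refine K m)) - between a b (seq t (refine K n)) ∣
      ≤⟨ between-lipschitz (seq t (refine K m)) (seq t (refine K n)) (regular t (refine K m) (refine K n)) ⟩
    (+ 1 / suc (refine K m) + + 1 / suc (refine K n)) * ι (+ K)
      ≃⟨ ℚ.*-distribʳ-+ (ι (+ K)) (+ 1 / suc (refine K m)) (+ 1 / suc (refine K n)) ⟩
    + 1 / suc (refine K m) * ι (+ K) + + 1 / suc (refine K n) * ι (+ K)
      ≤⟨ ℚ.+-mono-≤ (refine-* K 1 m) (refine-* K 1 n) ⟩
    + 1 / suc m + + 1 / suc n ∎
    where open ℚ.≤-Reasoning

  affine-continuous : ∀ ε → 0ℚᵘ ℚ.< ε → ∀ s t →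
                      Within (ε * (+ 1 / suc K)) s t → Within ε (affine s) (affine t)
  affine-continuous ε 0<ε s t close n = begin
    ∣ between a b (seq s (refine K n)) - between a b (seq t (refine K n)) ∣
      ≤⟨ between-lipschitz (seq s (refine K n)) (seq t (refine K n)) (close (refine K n)) ⟩
    (ε * (+ 1 / suc K) + + 2 / suc (refine K n)) * ι (+ K)
      ≃⟨ ℚ.*-distribʳ-+ (ι (+ K)) (ε * (+ 1 / suc K)) (+ 2 / suc (refine K n)) ⟩
    ε * (+ 1 / suc K) * ι (+ K) + + 2 / suc (refine K n) * ι (+ K)
      ≤⟨ ℚ.+-mono-≤ shrink (refine-* K 2 n) ⟩
    ε + + 2 / suc n ∎
    where
    open ℚ.≤-Reasoning
    instance
      ε≥0 : ℚ.NonNegative ε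
      ε≥0 = ℚ.nonNegative (ℚ.<⇒≤ 0<ε)
    K/1+K≤1 : + 1 / suc K * ι (+ K) ℚ.≤ 1ℚᵘ
    K/1+K≤1 = *≤* (ℤ.≤-trans (ℤ.≤-reflexive (trans (ℤ.*-identityʳ _) (ℤ.*-identityˡ (+ K))))
      (ℤ.≤-trans (ℤ.+≤+ (ℕ.≤-trans (ℕ.n≤1+n K) (ℕ.≤-reflexive (sym (ℕ.*-identityʳ (suc K))))))
        (ℤ.≤-reflexive (sym (ℤ.*-identityˡ _)))))
    shrink : ε * (+ 1 / suc K) * ι (+ K) ℚ.≤ ε
    shrink = begin
      ε * (+ 1 / suc K) * ι (+ K)   ≃⟨ ℚ.*-assoc ε (+ 1 / suc K) (ι (+ K)) ⟩
      ε * (+ 1 / suc K * ι (+ K))   ≤⟨ ℚ.*-monoʳ-≤-nonNeg ε K/1+K≤1 ⟩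
      ε * 1ℚᵘ                       ≃⟨ ℚ.*-identityʳ ε ⟩
      ε                             ∎

≃⇒≈ : ∀ {x y} → (∀ n → seq x n ≃ seq y n) → x ≈ y
≃⇒≈ {x} {y} eq n = ℚ.≤-trans
  (ℚ.≤-reflexive (ℚ.∣-∣-cong (ℚ.p≃q⇒p-q≃0 (seq x n) (seq y n) (eq n))))
  (ℚ.nonNegative⁻¹ (+ 2 / suc n))

-- One slope bound for both coordinates, so that both sample the parameter at the same indices and
-- `Meet` can speak of a single σ.
steepness : ℤ² → ℤ² → ℕ
steepness (px , py) (qx , qy) = ℤ.∣ qx ℤ.- px ∣ ℕ.+ ℤ.∣ qy ℤ.- py ∣

bounded : ∀ a b {K} → ℤ.∣ b ℤ.- a ∣ ℕ.≤ K → Bounded K a b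
bounded a b {K} le = mkBounded (ℚ.≤-respˡ-≃ (ℚ.∣-∣-cong (ι-- b a))
  (*≤* (ℤ.*-monoʳ-≤-nonNeg (+ 1) (ℤ.+≤+ le))))

module _ (P Q : ℤ²) where
  private K = steepness P Q

  boundˣ : Bounded K (proj₁ P) (proj₁ Q)
  boundˣ = bounded (proj₁ P) (proj₁ Q) (ℕ.m≤m+n _ _)

  boundʸ : Bounded K (proj₂ P) (proj₂ Q)
  boundʸ = bounded (proj₂ P) (proj₂ Q) (ℕ.m≤n+m _ _)

  samples : 𝕀 → ℕ → ℚᵘ
  samples t n = seq (val t) (refine K n)

  segment : 𝕀 → ℝ²
  segment t = affine boundˣ (val t) , affine boundʸ (val t)

  segment-arc : Separated P P Q Q → Arc
  segment-arc (separated ℓ h P≤ _ <Q _) = record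
    { at         = segment
    -- δ = ε/(K + 1): a Lipschitz modulus that is defined without knowing K to be nonzero.
    ; continuous = λ ε 0<ε → ε * (+ 1 / suc K) ,
        ℚ.positive⁻¹ (ε * (+ 1 / suc K)) {{ℚ.pos*pos⇒pos ε {{ℚ.positive 0<ε}} (+ 1 / suc K)}} ,
        λ s t close → affine-continuous boundˣ ε 0<ε (val s) (val t) close ,
                      affine-continuous boundʸ ε 0<ε (val s) (val t) close
    ; injective  = λ s t (x , y) → vanishes⇒≈ (n≤refine K) (val s) (val t)
        (between-injective {σ = samples s} {samples t} (ℤ.≤-<-trans P≤ <Q)
          (meet-· {P} {Q} {P} {Q} {samples s} {samples t} ℓ
            (meets (≈⇒vanishes {affine boundˣ (val s)} {affine boundˣ (val t)} x)
                  (≈⇒vanishes {affine boundʸ (val s)} {affine boundʸ (val t)} y))))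
    }

  samples-vanish⇒≈ : ∀ t x → Vanishes (λ n → samples t n - seq x (refine K n)) → val t ≈ x
  samples-vanish⇒≈ t x = vanishes⇒≈ (n≤refine K) (val t) x

  samples∈ : ∀ t → InUnit (samples t)
  samples∈ (mk𝕀 t 0≤t t≤1) =
    lim 2 (λ n → ℚ.≤-trans (0≤t (refine K n)) (ℚ.+-monoʳ-≤ (seq t (refine K n)) (2/suc-anti (n≤refine K n)))) ,
    lim 2 (λ n → ℚ.≤-respʳ-≃
      (solve 2 (λ t c → (con 1ℚᵘ :+ c) :- t := (con 1ℚᵘ :- t) :+ c) ℚ.≃-refl (seq t (refine K n)) (+ 2 / suc n))
      (ℚ.p≤q⇒0≤q-p (ℚ.≤-trans (t≤1 (refine K n)) (ℚ.+-monoʳ-≤ 1ℚᵘ (2/suc-anti (n≤refine K n))))))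
    where
    open ℚSolver
    2/suc-anti : ∀ {m n} → m ℕ.≤ n → + 2 / suc n ℚ.≤ + 2 / suc m
    2/suc-anti m≤n = *≤* (ℤ.+≤+ (ℕ.*-monoʳ-≤ 2 (ℕ.s≤s m≤n)))

embed : ℤ² → ℝ²
embed (x , y) = fromℚ (ι x) , fromℚ (ι y)

segment-start : ∀ P Q → segment P Q 0𝕀 ≈² embed P
segment-start P@(px , py) Q@(qx , qy) = start px qx (boundˣ P Q) , start py qy (boundʸ P Q)
  where
  open ℚSolver
  start : ∀ a b {K} (bd : Bounded K a b) → affine bd 0ℝ ≈ fromℚ (ι a)
  start a b bd = ≃⇒≈ {affine bd 0ℝ} {fromℚ (ι a)} λ n →
    solve 2 (λ a b → a :+ con 0ℚᵘ :* (b :- a) := a) ℚ.≃-refl (ι a) (ι b)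

segment-end : ∀ P Q → segment P Q 1𝕀 ≈² embed Q
segment-end P@(px , py) Q@(qx , qy) = end px qx (boundˣ P Q) , end py qy (boundʸ P Q)
  where
  open ℚSolver
  end : ∀ a b {K} (bd : Bounded K a b) → affine bd 1ℝ ≈ fromℚ (ι b)
  end a b bd = ≃⇒≈ {affine bd 1ℝ} {fromℚ (ι b)} λ n →
    solve 2 (λ a b → a :+ con 1ℚᵘ :* (b :- a) := b) ℚ.≃-refl (ι a) (ι b)

-- The parameter used on the degenerate segment from W to W that represents a vertex.
0ˢ : ℕ → ℚᵘ
0ˢ _ = 0ℚᵘ

0ˢ∈ : InUnit 0ˢ
0ˢ∈ = lim 0 (λ n → ℚ.nonNegative⁻¹ (0ℚᵘ + + 0 / suc n)) , lim 0 (λ n → ℚ.nonNegative⁻¹ (1ℚᵘ - 0ℚᵘ + + 0 / suc n))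

segments-meet : ∀ P Q R S {s t} → segment P Q s ≈² segment R S t → Meet P Q R S (samples P Q s) (samples R S t)
segments-meet P Q R S {s} {t} (x , y) = meets
  (≈⇒vanishes {proj₁ (segment P Q s)} {proj₁ (segment R S t)} x)
  (≈⇒vanishes {proj₂ (segment P Q s)} {proj₂ (segment R S t)} y)

segment-point-meet : ∀ P Q W {s} → segment P Q s ≈² embed W → Meet P Q W W (samples P Q s) 0ˢ
segment-point-meet P Q (wx , wy) {s} (x , y) = meets
  (lift wx {proj₁ (segment P Q s)} x) (lift wy {proj₂ (segment P Q s)} y)
  where
  open ℚSolver
  lift : ∀ w {z} → z ≈ fromℚ (ι w) → Vanishes (λ n → seq z n - between w w 0ℚᵘ)
  lift w {z} v = vanishes-cong
    (λ n → solve 2 (λ z w → z :- w := z :- (w :+ con 0ℚᵘ :* (w :- w))) ℚ.≃-refl (seq z n) (ι w))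
    (≈⇒vanishes {z} {fromℚ (ι w)} v)

points-meet : ∀ V W → embed V ≈² embed W → Meet V V W W 0ˢ 0ˢ
points-meet (vx , vy) (wx , wy) (x , y) = meets (lift vx wx x) (lift vy wy y)
  where
  open ℚSolver
  lift : ∀ v w → fromℚ (ι v) ≈ fromℚ (ι w) → Vanishes (λ n → between v v 0ℚᵘ - between w w 0ℚᵘ)
  lift v w e = vanishes-cong
    (λ n → solve 2 (λ v w → v :- w := (v :+ con 0ℚᵘ :* (v :- v)) :- (w :+ con 0ℚᵘ :* (w :- w))) ℚ.≃-refl (ι v) (ι w))
    (≈⇒vanishes {fromℚ (ι v)} {fromℚ (ι w)} e)

-- The spiral

-- Spreads a finite check along the spiral: m = 6 is one cell, m = 48 is eight cells, a full turn
-- about the origin.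
periodic-induction : ∀ m .{{_ : NonZero m}} (P : ℕ → Set) →
                     (∀ {u} → u ℕ.< m → P u) → (∀ u → P u → P (m ℕ.+ u)) → ∀ u → P u
periodic-induction m P base step = <-rec P λ u rec → case u rec (u ℕ.<? m)
  where
  case : ∀ u → (∀ {v} → v ℕ.< u → P v) → Dec (u ℕ.< m) → P u
  case u rec (yes u<m) = base u<m
  case u rec (no u≮m) = subst P (ℕ.m+[n∸m]≡n m≤u) (step (u ∸ m) (rec (ℕ.∸-monoʳ-< (ℕ.>-nonZero⁻¹ m) m≤u)))
    where m≤u = ℕ.≮⇒≥ u≮m

-- Periodicity by pattern matching makes the shift by one cell a matter of computation, also at
-- `u + d`, because addition recurses on its left argument.
pattern 6+ u = suc (suc (suc (suc (suc (suc u)))))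

turn : ℤ² → ℤ²
turn (x , y) = x ℤ.- y , x ℤ.+ y

-- The six base points and the edges were found by computer search.
position : ℕ → ℤ²
position 0 = ℤ.- + 4 , ℤ.- + 1
position 1 = + 5 , + 11
position 2 = ℤ.- + 4 , + 4
position 3 = + 3 , + 15
position 4 = + 6 , + 16
position 5 = ℤ.- + 5 , + 2
position (6+ u) = turn (position u)

-- The edges leading up from u are {u, u + d} for d ∈ gaps u.
gaps : ℕ → List ℕ
gaps 0 = 5 ∷ 8 ∷ []
gaps 1 = 2 ∷ 3 ∷ []
gaps 2 = 1 ∷ 3 ∷ []
gaps 3 = 5 ∷ 7 ∷ []
gaps 4 = 3 ∷ 20 ∷ 32 ∷ []
gaps 5 = 1 ∷ 2 ∷ []
gaps (6+ u) = gaps u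

-- The edge {u, u + d} crosses {v, v + e}.  Vertices are numbered so that the
-- eight gaps occurring here are distinct, hence d alone determines the partner.
data Crosses : (u d v e : ℕ) → Set where
  cross₀ : ∀ {u} → Crosses u 8 (5 ℕ.+ u) 1
  cross₁ : ∀ {u} → Crosses u 5 (2 ℕ.+ u) 2
  cross₂ : ∀ {u} → Crosses u 7 (1 ℕ.+ u) 3
  cross₃ : ∀ {u} → Crosses u 32 (6 ℕ.+ u) 20

Mates : (u d v e : ℕ) → Set
Mates u d v e = Crosses u d v e ⊎ Crosses v e u d

mates-unique : ∀ {u d v e v′ e′} → Mates u d v e → Mates u d v′ e′ → v ≡ v′ × e ≡ e′
mates-unique (inj₁ cross₀) (inj₁ cross₀) = refl , refl
mates-unique (inj₁ cross₁) (inj₁ cross₁) = refl , refl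
mates-unique (inj₁ cross₂) (inj₁ cross₂) = refl , refl
mates-unique (inj₁ cross₃) (inj₁ cross₃) = refl , refl
mates-unique (inj₂ cross₀) (inj₂ cross₀) = refl , refl
mates-unique (inj₂ cross₁) (inj₂ cross₁) = refl , refl
mates-unique (inj₂ cross₂) (inj₂ cross₂) = refl , refl
mates-unique (inj₂ cross₃) (inj₂ cross₃) = refl , refl

-- Certificates under the shift by one cell

turn-· : ∀ ℓ z → turn ℓ · turn z ≡ + 2 ℤ.* (ℓ · z)
turn-· (a , b) (x , y) = solve 4 (λ a b x y →
  (a :- b) :* (x :- y) :+ (a :+ b) :* (x :+ y) := con (+ 2) :* (a :* x :+ b :* y)) refl a b x y
  where open ℤSolver

turn-≤ : ∀ ℓ z {h} → ℓ · z ℤ.≤ h → turn ℓ · turn z ℤ.≤ + 2 ℤ.* h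
turn-≤ ℓ z {h} p = subst (ℤ._≤ + 2 ℤ.* h) (sym (turn-· ℓ z)) (ℤ.*-monoˡ-≤-nonNeg (+ 2) p)

turn-≥ : ∀ ℓ z {h} → h ℤ.≤ ℓ · z → + 2 ℤ.* h ℤ.≤ turn ℓ · turn z
turn-≥ ℓ z {h} p = subst (+ 2 ℤ.* h ℤ.≤_) (sym (turn-· ℓ z)) (ℤ.*-monoˡ-≤-nonNeg (+ 2) p)

turn-> : ∀ ℓ z {h} → h ℤ.< ℓ · z → + 2 ℤ.* h ℤ.< turn ℓ · turn z
turn-> ℓ z {h} p = subst (+ 2 ℤ.* h ℤ.<_) (sym (turn-· ℓ z)) (ℤ.*-monoˡ-<-pos (+ 2) p)

touching-turn : ∀ {P Q R S} → Touching P Q R S → Touching (turn P) (turn Q) (turn R) (turn S)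
touching-turn {P} {Q} {R} {S} (touching ℓ h P≤ Q≤ ≤R ≤S strict) = touching (turn ℓ) (+ 2 ℤ.* h)
  (turn-≤ ℓ P P≤) (turn-≤ ℓ Q Q≤) (turn-≥ ℓ R ≤R) (turn-≥ ℓ S ≤S) (Sum.map (turn-> ℓ R) (turn-> ℓ S) strict)

separated-turn : ∀ {P Q R S} → Separated P Q R S → Separated (turn P) (turn Q) (turn R) (turn S)
separated-turn {P} {Q} {R} {S} (separated ℓ h P≤ Q≤ <R <S) = separated (turn ℓ) (+ 2 ℤ.* h)
  (turn-≤ ℓ P P≤) (turn-≤ ℓ Q Q≤) (turn-> ℓ R <R) (turn-> ℓ S <S)

transversal-turn : ∀ {P Q R S} → Transversal P Q R S → Transversal (turn P) (turn Q) (turn R) (turn S)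
transversal-turn {P} {Q} {R} {S} (transversal ℓ P<Q R≡S) = transversal (turn ℓ)
  (subst (ℤ._< turn ℓ · turn Q) (sym (turn-· ℓ P)) (turn-> ℓ Q P<Q))
  (trans (turn-· ℓ R) (trans (cong (+ 2 ℤ.*_) R≡S) (sym (turn-· ℓ S))))

-- If the origin is not beyond the line, then scaling R and S by turn⁸ = 16 keeps
-- them beyond it.
record FarSeparated (P Q R S : ℤ²) : Set where
  constructor far-separated
  field
    separation : Separated P Q R S
    0≤level    : + 0 ℤ.≤ Separated.level separation

turn⁸ : ℤ² → ℤ²
turn⁸ z = turn (turn (turn (turn (turn (turn (turn (turn z)))))))

-- Repeated squaring: (1 + i)² = 2i, (1 + i)⁴ = -4, (1 + i)⁸ = 16.
·-turn⁸ : ∀ ℓ z → ℓ · turn⁸ z ≡ + 16 ℤ.* (ℓ · z)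
·-turn⁸ (a , b) (x , y) = trans
  (cong₂ (λ x y → a ℤ.* x ℤ.+ b ℤ.* y) (cong proj₁ turn⁸≡) (cong proj₂ turn⁸≡))
  (solve 4 (λ a b x y → a :* (con (+ 16) :* x) :+ b :* (con (+ 16) :* y) := con (+ 16) :* (a :* x :+ b :* y)) refl a b x y)
  where
  open ℤSolver
  turn² : ∀ x y → turn (turn (x , y)) ≡ (ℤ.- (+ 2 ℤ.* y) , + 2 ℤ.* x)
  turn² x y = cong₂ _,_
    (solve 2 (λ x y → (x :- y) :- (x :+ y) := :- (con (+ 2) :* y)) refl x y)
    (solve 2 (λ x y → (x :- y) :+ (x :+ y) := con (+ 2) :* x) refl x y)
  turn⁴ : ∀ x y → turn (turn (turn (turn (x , y)))) ≡ (ℤ.- (+ 4 ℤ.* x) , ℤ.- (+ 4 ℤ.* y))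
  turn⁴ x y = trans (cong (turn ∘ turn) (turn² x y)) (trans (turn² (ℤ.- (+ 2 ℤ.* y)) (+ 2 ℤ.* x)) (cong₂ _,_
    (solve 1 (λ x → :- (con (+ 2) :* (con (+ 2) :* x)) := :- (con (+ 4) :* x)) refl x)
    (solve 1 (λ y → con (+ 2) :* (:- (con (+ 2) :* y)) := :- (con (+ 4) :* y)) refl y)))
  turn⁸≡ : turn⁸ (x , y) ≡ (+ 16 ℤ.* x , + 16 ℤ.* y)
  turn⁸≡ = trans (cong (turn ∘ turn ∘ turn ∘ turn) (turn⁴ x y)) (trans (turn⁴ (ℤ.- (+ 4 ℤ.* x)) (ℤ.- (+ 4 ℤ.* y)))
    (cong₂ _,_ (quad x) (quad y)))
    where
    quad : ∀ x → ℤ.- (+ 4 ℤ.* (ℤ.- (+ 4 ℤ.* x))) ≡ + 16 ℤ.* x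
    quad = solve 1 (λ x → :- (con (+ 4) :* (:- (con (+ 4) :* x))) := con (+ 16) :* x) refl

far-turn : ∀ {P Q R S} → FarSeparated P Q R S → FarSeparated (turn P) (turn Q) (turn R) (turn S)
far-turn (far-separated s 0≤h) = far-separated (separated-turn s) (ℤ.*-monoˡ-≤-nonNeg (+ 2) 0≤h)

far-turn⁸ : ∀ {P Q R S} → FarSeparated P Q R S → FarSeparated P Q (turn⁸ R) (turn⁸ S)
far-turn⁸ {R = R} {S} (far-separated (separated ℓ h P≤ Q≤ <R <S) 0≤h) =
  far-separated (separated ℓ h P≤ Q≤ (grow R <R) (grow S <S)) 0≤h
  where
  grow : ∀ z → h ℤ.< ℓ · z → h ℤ.< ℓ · turn⁸ z
  grow z h<z = subst (h ℤ.<_) (sym (·-turn⁸ ℓ z)) (ℤ.<-≤-trans h<z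
    (ℤ.≤-trans (ℤ.≤-reflexive (sym (ℤ.*-identityˡ (ℓ · z))))
      (ℤ.*-monoʳ-≤-nonNeg (ℓ · z) {{ℤ.nonNegative (ℤ.≤-trans 0≤h (ℤ.<⇒≤ h<z))}} {+ 1} {+ 16} (ℤ.+≤+ (s≤s z≤n)))))

-- Decidable tests on nearby pairs

normal : ℤ² → ℤ² → ℤ²
normal (px , py) (qx , qy) = py ℤ.- qy , qx ℤ.- px

-- If two segments not on a common line do not cross, then the line through one of them leaves the
-- other on one closed side. So only the lines through the edges themselves need trying, with either
-- sign of the normal.
EitherSide : (ℤ² → Set) → ℤ² → ℤ² → Set
EitherSide A P Q = A (normal P Q) ⊎ A (normal Q P)

eitherSide? : ∀ {A : ℤ² → Set} → (∀ ℓ → Dec (A ℓ)) → ∀ P Q → Dec (EitherSide A P Q)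
eitherSide? A? P Q = A? (normal P Q) ⊎-dec A? (normal Q P)

TouchTest SeparationTest TransversalTest : ℤ² → ℤ² → ℤ² → ℤ² → Set
TouchTest P Q R S = EitherSide (λ ℓ → ℓ · Q ℤ.≤ ℓ · P × ℓ · P ℤ.≤ ℓ · R × ℓ · P ℤ.≤ ℓ · S ×
  (ℓ · P ℤ.< ℓ · R ⊎ ℓ · P ℤ.< ℓ · S)) P Q
SeparationTest P Q R S = EitherSide (λ ℓ → ℓ · Q ℤ.≤ ℓ · P × ℓ · P ℤ.< ℓ · R × ℓ · P ℤ.< ℓ · S) P Q
TransversalTest P Q R S = EitherSide (λ ℓ → ℓ · P ℤ.< ℓ · Q × ℓ · R ≡ ℓ · S) R S

touchTest? : ∀ P Q R S → Dec (TouchTest P Q R S)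
touchTest? P Q R S = eitherSide? (λ ℓ → ℓ · Q ℤ.≤? ℓ · P ×-dec ℓ · P ℤ.≤? ℓ · R ×-dec ℓ · P ℤ.≤? ℓ · S ×-dec
  (ℓ · P ℤ.<? ℓ · R ⊎-dec ℓ · P ℤ.<? ℓ · S)) P Q

separationTest? : ∀ P Q R S → Dec (SeparationTest P Q R S)
separationTest? P Q R S = eitherSide? (λ ℓ → ℓ · Q ℤ.≤? ℓ · P ×-dec ℓ · P ℤ.<? ℓ · R ×-dec ℓ · P ℤ.<? ℓ · S) P Q

transversalTest? : ∀ P Q R S → Dec (TransversalTest P Q R S)
transversalTest? P Q R S = eitherSide? (λ ℓ → ℓ · P ℤ.<? ℓ · Q ×-dec ℓ · R ℤ.≟ ℓ · S) R S

touch : ∀ {P Q R S} → TouchTest P Q R S → Touching P Q R S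
touch {P} {Q} (inj₁ (a , b , c , d)) = touching (normal P Q) _ ℤ.≤-refl a b c d
touch {P} {Q} (inj₂ (a , b , c , d)) = touching (normal Q P) _ ℤ.≤-refl a b c d

separate : ∀ {P Q R S} → SeparationTest P Q R S → Separated P Q R S
separate {P} {Q} (inj₁ (a , b , c)) = separated (normal P Q) _ ℤ.≤-refl a b c
separate {P} {Q} (inj₂ (a , b , c)) = separated (normal Q P) _ ℤ.≤-refl a b c

transverse : ∀ {P Q R S} → TransversalTest P Q R S → Transversal P Q R S
transverse {R = R} {S} (inj₁ (a , b)) = transversal (normal R S) a b
transverse {R = R} {S} (inj₂ (a , b)) = transversal (normal S R) a b

-- ℓ points to the midpoint of RS.
FarTest : ℤ² → ℤ² → ℤ² → ℤ² → Set
FarTest P Q R S = h ℤ.< ℓ · R × h ℤ.< ℓ · S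
  where
  ℓ = proj₁ R ℤ.+ proj₁ S , proj₂ R ℤ.+ proj₂ S
  h = + 0 ℤ.⊔ (ℓ · P ℤ.⊔ ℓ · Q)

farTest? : ∀ P Q R S → Dec (FarTest P Q R S)
farTest? P Q R S = _ ℤ.<? _ ×-dec _ ℤ.<? _

far-separate : ∀ {P Q R S} → FarTest P Q R S → FarSeparated P Q R S
far-separate {P} {Q} {R} {S} (a , b) = far-separated
  (separated ℓ h
    (ℤ.≤-trans (ℤ.i≤i⊔j _ _) (ℤ.i≤j⊔i (+ 0) _))
    (ℤ.≤-trans (ℤ.i≤j⊔i (ℓ · P) (ℓ · Q)) (ℤ.i≤j⊔i (+ 0) _)) a b)
  (ℤ.i≤i⊔j (+ 0) _)
  where
  ℓ = proj₁ R ℤ.+ proj₁ S , proj₂ R ℤ.+ proj₂ S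
  h = + 0 ℤ.⊔ (ℓ · P ℤ.⊔ ℓ · Q)

OnEdges : (ℤ² → ℤ² → ℤ² → ℤ² → Set) → ℕ → ℕ → ℕ → ℕ → Set
OnEdges A u d v e = A (position u) (position (u ℕ.+ d)) (position v) (position (v ℕ.+ e))

-- d = 0 stands for the vertex u itself.
Far : ℕ → ℕ → Set
Far u v = All (λ d → All (OnEdges FarSeparated u d v) (0 ∷ gaps v)) (0 ∷ gaps u)

-- The offset 38 exceeds the longest gap 32, so edges up from u and edges up from v share no end and
-- strict separation can be required. The window of 48 offsets is one full turn.
far-check : ∀ {u} → u ℕ.< 6 → ∀ {k} → k ℕ.< 48 → let v = u ℕ.+ (38 ℕ.+ k) in
            All (λ d → All (OnEdges FarTest u d v) (0 ∷ gaps v)) (0 ∷ gaps u)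
far-check = toWitness {a? = ℕ.allUpTo? (λ u → ℕ.allUpTo? (λ k → let v = u ℕ.+ (38 ℕ.+ k) in
  all? (λ d → all? (λ e → farTest? (position u) (position (u ℕ.+ d)) (position v) (position (v ℕ.+ e)))
    (0 ∷ gaps v)) (0 ∷ gaps u)) 48) 6} _

far : ∀ u k → Far u (u ℕ.+ (38 ℕ.+ k))
far = periodic-induction 6 _
  -- The induction on u turns both edges by one cell; the one on k scales only the edge at v, by
  -- `turn⁸`.
  (λ {u} u<6 → periodic-induction 48 _
    (λ k<48 → All.map (All.map far-separate) (far-check u<6 k<48))
    λ k p → subst (Far u) (shift u k) (All.map (All.map far-turn⁸) p))
  λ u p k → All.map (All.map far-turn) (p k)
  where
  shift : ∀ u k → 48 ℕ.+ (u ℕ.+ (38 ℕ.+ k)) ≡ u ℕ.+ (38 ℕ.+ (48 ℕ.+ k))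
  shift u k = trans (sym (ℕ.+-assoc 48 u (38 ℕ.+ k)))
    (trans (cong (ℕ._+ (38 ℕ.+ k)) (ℕ.+-comm 48 u)) (ℕ.+-assoc u 48 (38 ℕ.+ k)))

-- A crossing pair carries `Transversal` both ways, since the crossing must be unique as seen from
-- either edge.
data EdgePair (u d v e : ℕ) : Set where
  same  : u ≡ v → d ≡ e → EdgePair u d v e
  cross : Crosses u d v e → OnEdges Transversal u d v e → OnEdges Transversal v e u d → EdgePair u d v e
  low   : OnEdges Touching u d v e → EdgePair u d v e
  high  : OnEdges Touching v e u d → EdgePair u d v e

crosses-6+ : ∀ {u d v e} → Crosses u d v e → Crosses (6+ u) d (6+ v) e
crosses-6+ cross₀ = cross₀
crosses-6+ cross₁ = cross₁
crosses-6+ cross₂ = cross₂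
crosses-6+ cross₃ = cross₃

edgePair-6+ : ∀ {u d v e} → EdgePair u d v e → EdgePair (6+ u) d (6+ v) e
edgePair-6+ (same u≡v d≡e) = same (cong (6 ℕ.+_) u≡v) d≡e
edgePair-6+ (cross x t t′) = cross (crosses-6+ x) (transversal-turn t) (transversal-turn t′)
edgePair-6+ (low t)        = low (touching-turn t)
edgePair-6+ (high t)       = high (touching-turn t)

CrossTest : (d g e : ℕ) → Set
CrossTest d g e = (d , g , e) ∈ (8 , 5 , 1) ∷ (5 , 2 , 2) ∷ (7 , 1 , 3) ∷ (32 , 6 , 20) ∷ []

crosses : ∀ u {d g e} → CrossTest d g e → Crosses u d (u ℕ.+ g) e
crosses u (here refl) rewrite ℕ.+-comm u 5 = cross₀
crosses u (there (here refl)) rewrite ℕ.+-comm u 2 = cross₁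
crosses u (there (there (here refl))) rewrite ℕ.+-comm u 1 = cross₂
crosses u (there (there (there (here refl)))) rewrite ℕ.+-comm u 6 = cross₃

PairTest : (u d g e : ℕ) → Set
PairTest u d g e = (0 ≡ g × d ≡ e) ⊎
  (CrossTest d g e × OnEdges TransversalTest u d (u ℕ.+ g) e × OnEdges TransversalTest (u ℕ.+ g) e u d) ⊎
  OnEdges TouchTest u d (u ℕ.+ g) e ⊎ OnEdges TouchTest (u ℕ.+ g) e u d

pairTest? : ∀ u d g e → Dec (PairTest u d g e)
pairTest? u d g e = (0 ℕ.≟ g ×-dec d ℕ.≟ e) ⊎-dec
  ((d , g , e) ∈³? _ ×-dec transversalTest? P Q R S ×-dec transversalTest? R S P Q) ⊎-dec
  touchTest? P Q R S ⊎-dec touchTest? R S P Q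
  where
  P = position u
  Q = position (u ℕ.+ d)
  R = position (u ℕ.+ g)
  S = position (u ℕ.+ g ℕ.+ e)

edgePair : ∀ {u d g e} → PairTest u d g e → EdgePair u d (u ℕ.+ g) e
edgePair {u} (inj₁ (refl , d≡e)) = same (sym (ℕ.+-identityʳ u)) d≡e
edgePair {u} (inj₂ (inj₁ (x , t , t′))) = cross (crosses u x) (transverse t) (transverse t′)
edgePair (inj₂ (inj₂ (inj₁ t))) = low (touch t)
edgePair (inj₂ (inj₂ (inj₂ t))) = high (touch t)

EdgePairs : ℕ → ℕ → Set
EdgePairs u v = All (λ d → All (EdgePair u d v) (gaps v)) (gaps u)

pair-check : ∀ {u} → u ℕ.< 6 → ∀ {g} → g ℕ.< 38 →
             All (λ d → All (λ e → PairTest u d g e) (gaps (u ℕ.+ g))) (gaps u)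
pair-check = toWitness {a? = ℕ.allUpTo? (λ u → ℕ.allUpTo? (λ g →
  all? (λ d → all? (pairTest? u d g) (gaps (u ℕ.+ g))) (gaps u)) 38) 6} _

near-pairs : ∀ u {g} → g ℕ.< 38 → EdgePairs u (u ℕ.+ g)
near-pairs = periodic-induction 6 _
  (λ u<6 g<38 → All.map (All.map edgePair) (pair-check u<6 g<38))
  (λ u p g<38 → All.map (All.map edgePair-6+) (p g<38))

edge-pairs : ∀ {u v} → u ℕ.≤ v → EdgePairs u v
edge-pairs {u} {v} u≤v = subst (EdgePairs u) (ℕ.m+[n∸m]≡n u≤v) (go (v ∸ u ℕ.<? 38))
  where
  go : Dec (v ∸ u ℕ.< 38) → EdgePairs u (u ℕ.+ (v ∸ u))
  go (yes g<38) = near-pairs u g<38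
  -- The two tails drop the entries 0, which stand for the vertices.
  go (no g≮38) = All.map (All.map (low ∘ weaken) ∘ All.tail)
    (All.tail (subst (λ g → Far u (u ℕ.+ g)) (ℕ.m+[n∸m]≡n (ℕ.≮⇒≥ g≮38)) (far u (v ∸ u ∸ 38))))
    where
    weaken : ∀ {P Q R S} → FarSeparated P Q R S → Touching P Q R S
    weaken (far-separated (separated ℓ h P≤ Q≤ <R <S) _) =
      touching ℓ h P≤ Q≤ (ℤ.<⇒≤ <R) (ℤ.<⇒≤ <S) (inj₁ <R)

-- Edges against vertices

Avoids : (u d w : ℕ) → Set
Avoids u d w = Separated (position u) (position (u ℕ.+ d)) (position w) (position w) ⊎
               Separated (position w) (position w) (position u) (position (u ℕ.+ d))

-- Meant for u ≤ v. An edge up from v cannot end at u, so `below` makes an exception for u = v only,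
-- whereas an edge up from u may end at v.
record VertexPair (u v : ℕ) : Set where
  constructor vertexPair
  field
    distinct : u ≡ v ⊎ Separated (position u) (position u) (position v) (position v)
    above    : All (λ d → u ≡ v ⊎ u ℕ.+ d ≡ v ⊎ Avoids u d v) (gaps u)
    below    : All (λ d → u ≡ v ⊎ Avoids v d u) (gaps v)

vertexPair-6+ : ∀ {u v} → VertexPair u v → VertexPair (6+ u) (6+ v)
vertexPair-6+ (vertexPair d a b) = vertexPair
  (Sum.map (cong (6 ℕ.+_)) separated-turn d)
  (All.map (Sum.map (cong (6 ℕ.+_)) (Sum.map (cong (6 ℕ.+_)) (Sum.map separated-turn separated-turn))) a)
  (All.map (Sum.map (cong (6 ℕ.+_)) (Sum.map separated-turn separated-turn)) b)

displacement : ℤ² → ℤ² → ℤ²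
displacement (px , py) (qx , qy) = qx ℤ.- px , qy ℤ.- py

-- Two points come with no edge to supply a normal, so their displacement serves as the form.
PointTest : ℤ² → ℤ² → Set
PointTest P Q = displacement P Q · P ℤ.< displacement P Q · Q

VertexTest : ℕ → ℕ → Set
VertexTest u g = 0 ≡ g ⊎ PointTest P R ×
  All (λ d → d ≡ g ⊎ SeparationTest P (position (u ℕ.+ d)) R R) (gaps u) ×
  All (λ d → SeparationTest R (position (u ℕ.+ g ℕ.+ d)) P P) (gaps (u ℕ.+ g))
  where
  P = position u
  R = position (u ℕ.+ g)

vertexTest? : ∀ u g → Dec (VertexTest u g)
vertexTest? u g = 0 ℕ.≟ g ⊎-dec _ ℤ.<? _ ×-dec
  all? (λ d → d ℕ.≟ g ⊎-dec separationTest? P (position (u ℕ.+ d)) R R) (gaps u) ×-dec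
  all? (λ d → separationTest? R (position (u ℕ.+ g ℕ.+ d)) P P) (gaps (u ℕ.+ g))
  where
  P = position u
  R = position (u ℕ.+ g)

near-vertices : ∀ u {g} → g ℕ.< 38 → VertexPair u (u ℕ.+ g)
near-vertices = periodic-induction 6 _ (λ {u} u<6 g<38 → pair u (check u<6 g<38)) λ u p g<38 → vertexPair-6+ (p g<38)
  where
  check : ∀ {u} → u ℕ.< 6 → ∀ {g} → g ℕ.< 38 → VertexTest u g
  check = toWitness {a? = ℕ.allUpTo? (λ u → ℕ.allUpTo? (vertexTest? u) 38) 6} _
  pair : ∀ u {g} → VertexTest u g → VertexPair u (u ℕ.+ g)
  pair u (inj₁ refl) = vertexPair (inj₁ u≡) (All.universal (λ _ → inj₁ u≡) _) (All.universal (λ _ → inj₁ u≡) _)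
    where u≡ = sym (ℕ.+-identityʳ u)
  pair u {g} (inj₂ (p , a , b)) = vertexPair
    (inj₂ (separated (displacement (position u) (position (u ℕ.+ g))) _ ℤ.≤-refl ℤ.≤-refl p p))
    (All.map (λ t → inj₂ (Sum.map (cong (u ℕ.+_)) (inj₁ ∘ separate) t)) a)
    (All.map (λ t → inj₂ (inj₁ (separate t))) b)

far-vertices : ∀ {u v} → Far u v → VertexPair u v
far-vertices {u} {v} f = vertexPair
  (inj₂ (subst₂ (λ u′ v′ → Separated P (position u′) R (position v′)) u+0 v+0
    (FarSeparated.separation (All.head (All.head f)))))
  (All.map (λ {d} p → inj₂ (inj₂ (inj₁ (subst (λ v′ → Separated P (position (u ℕ.+ d)) R (position v′)) v+0
    (FarSeparated.separation (All.head p)))))) (All.tail f))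
  (All.map (λ {d} s → inj₂ (inj₂ (subst (λ u′ → Separated P (position u′) R (position (v ℕ.+ d))) u+0
    (FarSeparated.separation s)))) (All.tail (All.head f)))
  where
  P = position u
  R = position v
  u+0 = ℕ.+-identityʳ u
  v+0 = ℕ.+-identityʳ v

vertex-pairs : ∀ {u v} → u ℕ.≤ v → VertexPair u v
vertex-pairs {u} {v} u≤v = subst (VertexPair u) (ℕ.m+[n∸m]≡n u≤v) (go (v ∸ u ℕ.<? 38))
  where
  go : Dec (v ∸ u ℕ.< 38) → VertexPair u (u ℕ.+ (v ∸ u))
  go (yes g<38) = near-vertices u g<38
  go (no g≮38) = far-vertices (subst (λ g → Far u (u ℕ.+ g)) (ℕ.m+[n∸m]≡n (ℕ.≮⇒≥ g≮38)) (far u (v ∸ u ∸ 38)))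

-- Implies u < v: if v ≤ u, then v ∸ u = 0, which is no gap.
Up : ℕ → ℕ → Set
Up u v = v ∸ u ∈ gaps u

up? : ∀ u v → Dec (Up u v)
up? u v = v ∸ u ∈? gaps u

gap-bounds : ∀ u → All (λ d → 0 ℕ.< d × d ℕ.≤ 32) (gaps u)
gap-bounds = periodic-induction 6 _
  (toWitness {a? = ℕ.allUpTo? (λ u → all? (λ d → 0 ℕ.<? d ×-dec d ℕ.≤? 32) (gaps u)) 6} _) λ _ p → p

up⇒< : ∀ {u v} → Up u v → u ℕ.< v
up⇒< {u} {v} d∈ = ℕ.≰⇒> λ v≤u →
  ℕ.<-irrefl (sym (ℕ.m≤n⇒m∸n≡0 v≤u)) (proj₁ (All.lookup (gap-bounds u) d∈))

up-+ : ∀ {u v} → Up u v → u ℕ.+ (v ∸ u) ≡ v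
up-+ {u} p = ℕ.m+[n∸m]≡n (ℕ.<⇒≤ (up⇒< {u} p))

up-≤ : ∀ {u v} → Up u v → v ℕ.≤ u ℕ.+ 32
up-≤ {u} {v} d∈ = ℕ.≤-trans (ℕ.m≤n+m∸n v u) (ℕ.+-monoʳ-≤ u (proj₂ (All.lookup (gap-bounds u) d∈)))

Adj : ℕ → ℕ → Set
Adj u v = Up u v ⊎ Up v u

adj? : ∀ u v → Dec (Adj u v)
adj? u v = up? u v ⊎-dec up? v u

spiral : ∀ n → Graph n
spiral n = record
  { adj        = λ u v → ⌊ adj? (toℕ u) (toℕ v) ⌋
  ; adj-sym    = λ u v → fromWitness ∘ Sum.swap ∘ toWitness
  ; adj-irrefl = λ v → [ ℕ.<-irrefl refl ∘ up⇒< {toℕ v} , ℕ.<-irrefl refl ∘ up⇒< {toℕ v} ]′ ∘ toWitness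
  }

-- Girth

-- A triangle or square is inspected at its smallest vertex u, whose two neighbours on it are then u
-- + d and u + e. The corner opposite u is two edges up to 32 away, hence g ≤ 64; g = 0 is u itself.
NoShortCycle : ℕ → Set
NoShortCycle u = All (λ d → All (λ e → d ≡ e ⊎
  (¬ Adj (u ℕ.+ d) (u ℕ.+ e) ×
   (∀ {g} → g ℕ.< 65 → 0 ≡ g ⊎ ¬ (Adj (u ℕ.+ d) (u ℕ.+ g) × Adj (u ℕ.+ e) (u ℕ.+ g)))))
  (gaps u)) (gaps u)

abstract
  noShortCycle : ∀ u → NoShortCycle u
  noShortCycle = periodic-induction 6 _
    (toWitness {a? = ℕ.allUpTo? (λ u → all? (λ d → all? (λ e → d ℕ.≟ e ⊎-dec
      (¬? (adj? (u ℕ.+ d) (u ℕ.+ e)) ×-dec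
       ℕ.allUpTo? (λ g → 0 ℕ.≟ g ⊎-dec ¬? (adj? (u ℕ.+ d) (u ℕ.+ g) ×-dec adj? (u ℕ.+ e) (u ℕ.+ g))) 65))
      (gaps u)) (gaps u)) 6} _)
    -- Adding 6 to all vertices changes neither their truncated differences nor their gaps, so the
    -- claim at 6 + u computes to the claim at u.
    λ _ p → p

adj⇒up : ∀ {u v} → u ℕ.< v → Adj u v → Up u v
adj⇒up u<v (inj₁ p) = p
adj⇒up {u} {v} u<v (inj₂ p) = contradiction (up⇒< {v} p) (ℕ.<-asym u<v)

adj-≤ : ∀ {u v} → Adj u v → v ℕ.≤ u ℕ.+ 32
adj-≤ {u} (inj₁ p) = up-≤ {u} p
adj-≤ {u} {v} (inj₂ p) = ℕ.≤-trans (ℕ.<⇒≤ (up⇒< {v} p)) (ℕ.m≤m+n _ 32)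

minimal-triangle : ∀ {a b c} → a ℕ.< b → a ℕ.< c → b ≢ c → Adj a b → Adj a c → ¬ Adj b c
minimal-triangle {a} {b} {c} a<b a<c b≢c ab ac bc =
  [ (λ e → b≢c (trans (sym (up-+ {a} p)) (trans (cong (a ℕ.+_) e) (up-+ {a} q))))
  , (λ (¬bc , _) → ¬bc (subst₂ Adj (sym (up-+ {a} p)) (sym (up-+ {a} q)) bc))
  ]′ (All.lookup (All.lookup (noShortCycle a) p) q)
  where
  p = adj⇒up a<b ab
  q = adj⇒up a<c ac

minimal-square : ∀ {a b c d} → a ℕ.< b → a ℕ.< c → a ℕ.< d → b ≢ d →
                 Adj a b → Adj b c → Adj a d → ¬ Adj d c
minimal-square {a} {b} {c} {d} a<b a<c a<d b≢d ab bc ad dc =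
  [ (λ e → b≢d (trans (sym (up-+ {a} p)) (trans (cong (a ℕ.+_) e) (up-+ {a} q))))
  , (λ (_ , ¬c) → [ (λ 0≡ → ℕ.<-irrefl 0≡ (ℕ.m<n⇒0<n∸m a<c))
                  , (λ ¬dc → ¬dc (subst₂ Adj (sym (up-+ {a} p)) a+c bc , subst₂ Adj (sym (up-+ {a} q)) a+c dc))
                  ]′ (¬c c<65))
  ]′ (All.lookup (All.lookup (noShortCycle a) p) q)
  where
  p = adj⇒up a<b ab
  q = adj⇒up a<d ad
  a+c : c ≡ a ℕ.+ (c ∸ a)
  a+c = sym (ℕ.m+[n∸m]≡n (ℕ.<⇒≤ a<c))
  c<65 : c ∸ a ℕ.< 65
  c<65 = s≤s (ℕ.≤-trans (ℕ.∸-monoˡ-≤ a (ℕ.≤-trans (adj-≤ {b} bc) (ℕ.+-monoˡ-≤ 32 (up-≤ {a} p))))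
    (ℕ.≤-reflexive (trans (cong (_∸ a) (ℕ.+-assoc a 32 32)) (ℕ.m+n∸m≡n a 64))))

adj⇒≢ : ∀ {u v} → Adj u v → u ≢ v
adj⇒≢ {u} (inj₁ p) = ℕ.<⇒≢ (up⇒< {u} p)
adj⇒≢ {u} {v} (inj₂ p) = ℕ.<⇒≢ (up⇒< {v} p) ∘ sym

-- The vertices cannot increase, or decrease, all the way round, so some vertex lies below both
-- others.
triangle-free : ∀ a b c → Adj a b → Adj b c → ¬ Adj c a
triangle-free a b c ab bc ca with ℕ.<-cmp a b | ℕ.<-cmp b c | ℕ.<-cmp c a
... | tri≈ _ e _ | _ | _ = adj⇒≢ {a} ab e
... | _ | tri≈ _ e _ | _ = adj⇒≢ {b} bc e
... | _ | _ | tri≈ _ e _ = adj⇒≢ {c} ca e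
... | tri< a<b _ _ | _ | tri> _ _ a<c = minimal-triangle a<b a<c (adj⇒≢ {b} bc) ab (Sum.swap ca) bc
... | tri> _ _ b<a | tri< b<c _ _ | _ = minimal-triangle b<c b<a (adj⇒≢ {c} ca) bc (Sum.swap ab) ca
... | _ | tri> _ _ c<b | tri< c<a _ _ = minimal-triangle c<a c<b (adj⇒≢ {a} ab) ca (Sum.swap bc) ab
... | tri< a<b _ _ | tri< b<c _ _ | tri< c<a _ _ = ℕ.<-asym (ℕ.<-trans a<b b<c) c<a
... | tri> _ _ b<a | tri> _ _ c<b | tri> _ _ a<c = ℕ.<-asym (ℕ.<-trans c<b b<a) a<c

-- With both diagonals ordered, the smallest corner is a or b.
ordered-square-free : ∀ a b c d → a ℕ.< c → b ℕ.< d → Adj a b → Adj b c → Adj c d → ¬ Adj d a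
ordered-square-free a b c d a<c b<d ab bc cd da with ℕ.<-cmp a b
... | tri< a<b _ _ = minimal-square a<b a<c (ℕ.<-trans a<b b<d) (ℕ.<⇒≢ b<d) ab bc (Sum.swap da) (Sum.swap cd)
... | tri≈ _ a≡b _ = adj⇒≢ {a} ab a≡b
... | tri> _ _ b<a = minimal-square b<a b<d (ℕ.<-trans b<a a<c) (ℕ.<⇒≢ a<c) (Sum.swap ab) (Sum.swap da) bc cd

-- The symmetries of the square reverse either diagonal, which reduces to the ordered case.
square-free : ∀ a b c d → a ≢ c → b ≢ d → Adj a b → Adj b c → Adj c d → ¬ Adj d a
square-free a b c d a≢c b≢d ab bc cd da with ℕ.<-cmp a c | ℕ.<-cmp b d
... | tri≈ _ e _ | _ = a≢c e
... | _ | tri≈ _ e _ = b≢d e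
... | tri< a<c _ _ | tri< b<d _ _ = ordered-square-free a b c d a<c b<d ab bc cd da
... | tri< a<c _ _ | tri> _ _ d<b =
  ordered-square-free a d c b a<c d<b (Sum.swap da) (Sum.swap cd) (Sum.swap bc) (Sum.swap ab)
... | tri> _ _ c<a | tri< b<d _ _ =
  ordered-square-free c b a d c<a b<d (Sum.swap bc) (Sum.swap ab) (Sum.swap da) (Sum.swap cd)
... | tri> _ _ c<a | tri> _ _ d<b = ordered-square-free c d a b c<a d<b cd da ab bc

5≤len : ∀ {n} (c : Cycle (spiral n)) → 5 ℕ.≤ Cycle.len c
5≤len record { pred-len = 0 ; 3≤len = s≤s () }
5≤len record { pred-len = 1 ; 3≤len = s≤s (s≤s ()) }
5≤len record { pred-len = 2 ; vertex = v ; step = step ; close = close } = contradiction (toWitness close)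
  (triangle-free (toℕ (v (# 0))) (toℕ (v (# 1))) (toℕ (v (# 2))) (toWitness (step (# 0))) (toWitness (step (# 1))))
5≤len record { pred-len = 3 ; vertex = v ; distinct = distinct ; step = step ; close = close } =
  contradiction (toWitness close)
    (square-free (toℕ (v (# 0))) (toℕ (v (# 1))) (toℕ (v (# 2))) (toℕ (v (# 3)))
      (λ e → contradiction (distinct (Fin.toℕ-injective e)) λ ())
      (λ e → contradiction (distinct (Fin.toℕ-injective e)) λ ())
      (toWitness (step (# 0))) (toWitness (step (# 1))) (toWitness (step (# 2))))
5≤len record { pred-len = suc (suc (suc (suc _))) } = s≤s (s≤s (s≤s (s≤s (s≤s z≤n))))

pentagon : Fin 5 → Fin 9
-- The edges 0-5, 2-5, 2-3, 3-8, 0-8 have gaps 5, 3, 1, 5, 8.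
pentagon = lookup (# 0 ∷ # 5 ∷ # 2 ∷ # 3 ∷ # 8 ∷ [])

five-cycle : ∀ r → Cycle (spiral (9 ℕ.+ r))
five-cycle r = record
  { 3≤len    = s≤s (s≤s (s≤s z≤n))
  ; vertex   = λ i → pentagon i ↑ˡ r
  ; distinct = λ {i} {j} e → pentagon-injective i j (Fin.↑ˡ-injective r _ _ e)
  ; step     = λ { zero → _ ; (suc zero) → _ ; (suc (suc zero)) → _ ; (suc (suc (suc zero))) → _ }
  ; close    = _
  }
  where
  pentagon-injective : ∀ i j → pentagon i ≡ pentagon j → i ≡ j
  pentagon-injective = toWitness {a? = Fin.all? λ i → Fin.all? λ j → (pentagon i Fin.≟ pentagon j) →-dec (i Fin.≟ j)} _

girth-5 : ∀ {n} → 9 ℕ.≤ n → HasGirth (spiral n) 5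
girth-5 {n} 9≤n = subst (λ n → HasGirth (spiral n) 5) (ℕ.m+[n∸m]≡n 9≤n)
  ((five-cycle (n ∸ 9) , refl) , 5≤len)

-- The drawing

module _ {n : ℕ} where

  place : Fin n → ℤ²
  place v = position (toℕ v)

  private
    U : Edge (spiral n) → ℕ
    U e = toℕ (src e)

    gap : Edge (spiral n) → ℕ
    gap e = toℕ (tgt e) ∸ toℕ (src e)

    P Q : Edge (spiral n) → ℤ²
    P e = place (src e)
    Q e = place (tgt e)

  edge-up : (e : Edge (spiral n)) → Up (toℕ (src e)) (toℕ (tgt e))
  edge-up e = adj⇒up (src<tgt e) (toWitness (adjacent e))

  edge-+ : (e : Edge (spiral n)) → U e ℕ.+ gap e ≡ toℕ (tgt e)
  edge-+ e = up-+ {U e} (edge-up e)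

  edge-≡ : ∀ {e f : Edge (spiral n)} → U e ≡ U f → gap e ≡ gap f → e ≡ f
  edge-≡ {e} {f} u≡ d≡
    with Fin.toℕ-injective u≡
       | Fin.toℕ-injective (trans (sym (edge-+ e)) (trans (cong₂ ℕ._+_ u≡ d≡) (edge-+ f)))
  edge-≡ {edge s t p q} {edge .s .t p′ q′} u≡ d≡ | refl | refl =
    cong₂ (edge s t) (ℕ.<-irrelevant p p′) (T-irrelevant q q′)

  on-edges : ∀ {A : ℤ² → ℤ² → ℤ² → ℤ² → Set} e f → OnEdges A (U e) (gap e) (U f) (gap f) → A (P e) (Q e) (P f) (Q f)
  on-edges {A} e f = subst₂ (λ v w → A (P e) (position v) (P f) (position w)) (edge-+ e) (edge-+ f)

  -- `EdgePair` freed from the order of the lower ends. Only the transversality that fixes the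
  -- parameter on e is retained.
  data Encounter (e f : Edge (spiral n)) : Set where
    mates : Mates (U e) (gap e) (U f) (gap f) → Transversal (P e) (Q e) (P f) (Q f) → Encounter e f
    low   : Touching (P e) (Q e) (P f) (Q f) → Encounter e f
    high  : Touching (P f) (Q f) (P e) (Q e) → Encounter e f

  encounter : ∀ e f → f ≢ e → Encounter e f
  encounter e f f≢e with ℕ.≤-total (U e) (U f)
  ... | inj₁ u≤v with All.lookup (All.lookup (edge-pairs u≤v) (edge-up e)) (edge-up f)
  ...   | same u≡ d≡ = contradiction (sym (edge-≡ {e} {f} u≡ d≡)) f≢e
  ...   | cross x t _ = mates (inj₁ x) (on-edges {Transversal} e f t)
  ...   | low t = low (on-edges {Touching} e f t)
  ...   | high t = high (on-edges {Touching} f e t)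
  encounter e f f≢e | inj₂ v≤u with All.lookup (All.lookup (edge-pairs v≤u) (edge-up f)) (edge-up e)
  ...   | same u≡ d≡ = contradiction (edge-≡ {f} {e} u≡ d≡) f≢e
  ...   | cross x _ t = mates (inj₂ x) (on-edges {Transversal} e f t)
  ...   | low t = high (on-edges {Touching} f e t)
  ...   | high t = low (on-edges {Touching} e f t)

  edge-avoids : ∀ e w → w ≢ src e → w ≢ tgt e →
    Separated (P e) (Q e) (place w) (place w) ⊎ Separated (place w) (place w) (P e) (Q e)
  edge-avoids e w w≢s w≢t = subst
    (λ v → Separated (P e) (position v) (place w) (place w) ⊎ Separated (place w) (place w) (P e) (position v))
    (edge-+ e) ([ above , below ]′ (ℕ.≤-total (U e) (toℕ w)))
    where
    above : U e ℕ.≤ toℕ w → Avoids (U e) (gap e) (toℕ w)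
    above u≤w with All.lookup (VertexPair.above (vertex-pairs u≤w)) (edge-up e)
    ... | inj₁ u≡w = contradiction (Fin.toℕ-injective (sym u≡w)) w≢s
    ... | inj₂ (inj₁ v≡w) = contradiction (Fin.toℕ-injective (trans (sym v≡w) (edge-+ e))) w≢t
    ... | inj₂ (inj₂ s) = s
    below : toℕ w ℕ.≤ U e → Avoids (U e) (gap e) (toℕ w)
    below w≤u with All.lookup (VertexPair.below (vertex-pairs w≤u)) (edge-up e)
    ... | inj₁ w≡u = contradiction (Fin.toℕ-injective w≡u) w≢s
    ... | inj₂ s = s

  place-separated : ∀ {u v : Fin n} → u Fin.< v → Separated (place u) (place u) (place v) (place v)
  place-separated u<v with VertexPair.distinct (vertex-pairs (ℕ.<⇒≤ u<v))
  ... | inj₁ u≡v = contradiction u≡v (ℕ.<⇒≢ u<v)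
  ... | inj₂ s = s

  embed-injective : ∀ u v → embed (place u) ≈² embed (place v) → u ≡ v
  embed-injective u v eq with Fin.<-cmp u v
  ... | tri< u<v _ _ = contradiction (points-meet (place u) (place v) eq)
    (separated⇒¬meet (place-separated u<v) 0ˢ∈ 0ˢ∈)
  ... | tri≈ _ u≡v _ = u≡v
  ... | tri> _ _ v<u = contradiction (meet-sym (points-meet (place u) (place v) eq))
    (separated⇒¬meet (place-separated v<u) 0ˢ∈ 0ˢ∈)

  drawing : Drawing (spiral n)
  drawing = record
    { point           = embed ∘ place
    ; point-injective = embed-injective
    ; arc             = λ e → segment-arc (P e) (Q e) (place-separated (src<tgt e))
    ; starts          = λ e → segment-start (P e) (Q e)
    ; ends            = λ e → segment-end (P e) (Q e)
    ; avoids          = λ e w w≢s w≢t t eq →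
        let m = segment-point-meet (P e) (Q e) (place w) {t} eq in
        [ (λ s → separated⇒¬meet s (samples∈ (P e) (Q e) t) 0ˢ∈ m)
        , (λ s → separated⇒¬meet s 0ˢ∈ (samples∈ (P e) (Q e) t) (meet-sym m))
        ]′ (edge-avoids e w w≢s w≢t)
    }

  ¬interior-end : ∀ P Q {t} → Interior t → ¬ (Vanishes (samples P Q t) ⊎ Vanishes (λ n → samples P Q t n ℚ.- 1ℚᵘ))
  ¬interior-end P Q {t} (≉0 , _) (inj₁ v) = ≉0 (samples-vanish⇒≈ P Q t 0ℝ
    (vanishes-cong (λ n → ℚ.≃-sym (ℚ.+-identityʳ (samples P Q t n))) v))
  ¬interior-end P Q {t} (_ , ≉1) (inj₂ v) = ≉1 (samples-vanish⇒≈ P Q t 1ℝ v)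

  crossing-meets : ∀ {e} (c : Crossing drawing e) → let open Crossing c in
    Meet (P e) (Q e) (P other) (Q other) (samples (P e) (Q e) param) (samples (P other) (Q other) param′)
  crossing-meets {e} c = segments-meet (P e) (Q e) (P other) (Q other) {param} {param′} (Crossing.meet c)
    where open Crossing c using (other; param; param′)

  crossing-mates : ∀ {e} (c : Crossing drawing e) → let open Crossing c in
    Mates (U e) (gap e) (U other) (gap other) × Transversal (P e) (Q e) (P other) (Q other)
  crossing-mates {e} c with encounter e other other≢
    where open Crossing c
  ... | mates x t = x , t
  ... | low t = contradiction
    (touching⇒end t (samples∈ (P e) (Q e) param) (samples∈ (P other) (Q other) param′) (crossing-meets c))
    (¬interior-end (P other) (Q other) {param′} param′-interior)
    where open Crossing c
  ... | high t = contradiction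
    (touching⇒end t (samples∈ (P other) (Q other) param′) (samples∈ (P e) (Q e) param) (meet-sym (crossing-meets c)))
    (¬interior-end (P e) (Q e) {param} param-interior)
    where open Crossing c

  crossing-unique : ∀ {e} (c c′ : Crossing drawing e) → SameCrossing c c′
  crossing-unique {e} c c′ = other≡ , samples-vanish⇒≈ (P e) (Q e) (Crossing.param c) (val (Crossing.param c′))
    (transversal⇒unique (proj₂ (crossing-mates c)) (crossing-meets c)
      -- The samples on the other edge depend on that edge, so they are hidden in an existential
      -- before the transport.
      (subst (λ f → ∃ λ τ → Meet (P e) (Q e) (P f) (Q f) (samples (P e) (Q e) (Crossing.param c′)) τ) (sym other≡)
        (_ , crossing-meets c′) .proj₂))
    where
    other≡ : Crossing.other c ≡ Crossing.other c′
    other≡ = let v≡ , d≡ = mates-unique (proj₁ (crossing-mates c)) (proj₁ (crossing-mates c′)) in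
             edge-≡ {Crossing.other c} {Crossing.other c′} v≡ d≡

  1-planar : (1 -Planar) (spiral n)
  1-planar = drawing , λ e c → zero , suc zero , (λ ()) , crossing-unique (c zero) (c (suc zero))

-- Counting edges

unique-⊆⇒length-≤ : ∀ {A : Set} {xs ys : List A} → Unique xs → xs ⊆ ys → length xs ℕ.≤ length ys
unique-⊆⇒length-≤ {xs = []} _ _ = z≤n
unique-⊆⇒length-≤ {xs = x ∷ xs} (x∉xs ∷ xs!) xs⊆ys with ∈-∃++ (xs⊆ys (here refl))
... | as , bs , refl = begin
  suc (length xs)              ≤⟨ s≤s (unique-⊆⇒length-≤ xs! without) ⟩
  suc (length (as ++ bs))      ≡⟨ cong suc (length-++ as) ⟩
  suc (length as ℕ.+ length bs) ≡⟨ ℕ.+-suc (length as) (length bs) ⟨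
  length as ℕ.+ suc (length bs) ≡⟨ length-++ as ⟨
  length (as ++ x ∷ bs)        ∎
  where
  open ℕ.≤-Reasoning
  without : xs ⊆ as ++ bs
  without y∈xs with ∈-++⁻ as (xs⊆ys (there y∈xs))
  ... | inj₁ y∈as = ∈-++⁺ˡ y∈as
  ... | inj₂ (here y≡x) = contradiction (sym y≡x) (All.lookup x∉xs y∈xs)
  ... | inj₂ (there y∈bs) = ∈-++⁺ʳ as y∈bs

-- Edges of the infinite graph, bounded by their lower ends; the upper ends may exceed m.
arrows : ℕ → List (ℕ × ℕ)
arrows zero    = []
arrows (suc m) = map (λ d → m , m ℕ.+ d) (gaps m) ++ arrows m

∈-arrows : ∀ m {u v} → (u , v) ∈ arrows m → u ℕ.< m × Up u v
∈-arrows (suc m) p with ∈-++⁻ (map (λ d → m , m ℕ.+ d) (gaps m)) p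
... | inj₂ q = let u<m , up = ∈-arrows m q in ℕ.m≤n⇒m≤1+n u<m , up
... | inj₁ q with ∈-map⁻ _ q
...   | d , d∈ , refl = ℕ.≤-refl , subst (_∈ gaps m) (sym (ℕ.m+n∸m≡n m d)) d∈

gaps-unique : ∀ u → Unique (gaps u)
gaps-unique = periodic-induction 6 _ (toWitness {a? = ℕ.allUpTo? (unique? ∘ gaps) 6} _) λ _ p → p

arrows-unique : ∀ m → Unique (arrows m)
arrows-unique zero = []
arrows-unique (suc m) = ++⁺ (map⁺ (ℕ.+-cancelˡ-≡ m _ _ ∘ cong proj₂) (gaps-unique m)) (arrows-unique m) disjoint
  where
  disjoint : ∀ {e} → ¬ (e ∈ map (λ d → m , m ℕ.+ d) (gaps m) × e ∈ arrows m)
  disjoint (p , q) with ∈-map⁻ _ p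
  ... | d , _ , refl = ℕ.<-irrefl refl (proj₁ (∈-arrows m q))

arrows-6+ : ∀ m → length (arrows (6 ℕ.+ m)) ≡ 13 ℕ.+ length (arrows m)
arrows-6+ zero    = refl
arrows-6+ (suc m) = begin
  length (arrows (suc (6 ℕ.+ m)))                                ≡⟨ row (6 ℕ.+ m) ⟩
  length (gaps m) ℕ.+ length (arrows (6 ℕ.+ m))                  ≡⟨ cong (length (gaps m) ℕ.+_) (arrows-6+ m) ⟩
  length (gaps m) ℕ.+ (13 ℕ.+ length (arrows m))                 ≡⟨ solve 2 (λ a b →
      a :+ (con 13 :+ b) := con 13 :+ (a :+ b)) refl (length (gaps m)) (length (arrows m)) ⟩
  13 ℕ.+ (length (gaps m) ℕ.+ length (arrows m))                 ≡⟨ cong (13 ℕ.+_) (row m) ⟨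
  13 ℕ.+ length (arrows (suc m))                                 ∎
  where
  open ≡-Reasoning
  open ℕSolver
  row : ∀ k → length (arrows (suc k)) ≡ length (gaps k) ℕ.+ length (arrows k)
  row k = trans (length-++ (map (λ d → k , k ℕ.+ d) (gaps k))) (cong (ℕ._+ length (arrows k)) (length-map _ (gaps k)))

-- The deficit 13m - 6 · `length (arrows m)` has period 6. It peaks at 4 for m = 4, because each of
-- the vertices 0 to 3 has only two gaps.
arrows-many : ∀ m → 13 ℕ.* m ℕ.≤ 6 ℕ.* length (arrows m) ℕ.+ 4
arrows-many = periodic-induction 6 _
  (toWitness {a? = ℕ.allUpTo? (λ m → 13 ℕ.* m ℕ.≤? 6 ℕ.* length (arrows m) ℕ.+ 4) 6} _)
  λ m p → subst₂ ℕ._≤_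
    (solve 1 (λ m → con 78 :+ con 13 :* m := con 13 :* (con 6 :+ m)) refl m)
    (trans (solve 1 (λ l → con 78 :+ (con 6 :* l :+ con 4) := con 6 :* (con 13 :+ l) :+ con 4) refl (length (arrows m)))
      (cong (λ l → 6 ℕ.* l ℕ.+ 4) (sym (arrows-6+ m))))
    (ℕ.+-monoʳ-≤ 78 p)
  where open ℕSolver

edges-many : ∀ n → 13 ℕ.* n ℕ.≤ 6 ℕ.* edgeCount (spiral n) ℕ.+ 420
edges-many n = begin
  -- A lower end below n - 32 keeps the upper end below n. Giving up the last 32 lower ends costs 13
  -- · 32 = 416, and the slack 4 makes 420.
  13 ℕ.* n                                             ≤⟨ ℕ.*-monoʳ-≤ 13 (ℕ.m≤n+m∸n n 32) ⟩
  13 ℕ.* (32 ℕ.+ (n ∸ 32))                             ≡⟨ ℕ.*-distribˡ-+ 13 32 (n ∸ 32) ⟩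
  416 ℕ.+ 13 ℕ.* (n ∸ 32)                              ≤⟨ ℕ.+-monoʳ-≤ 416 (arrows-many (n ∸ 32)) ⟩
  416 ℕ.+ (6 ℕ.* length (arrows (n ∸ 32)) ℕ.+ 4)       ≤⟨ ℕ.+-monoʳ-≤ 416 (ℕ.+-monoˡ-≤ 4 (ℕ.*-monoʳ-≤ 6 few)) ⟩
  416 ℕ.+ (6 ℕ.* edgeCount (spiral n) ℕ.+ 4)           ≡⟨ solve 1 (λ c →
      con 416 :+ (con 6 :* c :+ con 4) := con 6 :* c :+ con 420) refl (edgeCount (spiral n)) ⟩
  6 ℕ.* edgeCount (spiral n) ℕ.+ 420                   ∎
  where
  open ℕ.≤-Reasoning
  open ℕSolver
  labels : Fin n × Fin n → ℕ × ℕ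
  labels (u , v) = toℕ u , toℕ v
  contained : arrows (n ∸ 32) ⊆ map labels (edges (spiral n))
  contained {u , v} p = subst (_∈ map labels (edges (spiral n))) (cong₂ _,_ (Fin.toℕ-fromℕ< u<n) (Fin.toℕ-fromℕ< v<n))
    (∈-map⁺ labels (∈-filter⁺ _ (∈-cartesianProduct⁺ (∈-allFin (fromℕ< u<n)) (∈-allFin (fromℕ< v<n)))
      ( subst₂ ℕ._<_ (sym (Fin.toℕ-fromℕ< u<n)) (sym (Fin.toℕ-fromℕ< v<n)) u<v
      , fromWitness (inj₁ (subst₂ Up (sym (Fin.toℕ-fromℕ< u<n)) (sym (Fin.toℕ-fromℕ< v<n)) up)))))
    where
    u<m = proj₁ (∈-arrows (n ∸ 32) p)
    up = proj₂ (∈-arrows (n ∸ 32) p)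
    u<v : u ℕ.< v
    u<v = up⇒< {u} up
    v<n : v ℕ.< n
    v<n = ℕ.≤-<-trans (up-≤ {u} up) (subst (u ℕ.+ 32 ℕ.<_)
      (ℕ.m∸n+n≡m {n} {32} (ℕ.<⇒≤ (ℕ.m∸n≢0⇒n<m (ℕ.m<n⇒n≢0 u<m)))) (ℕ.+-monoˡ-< 32 u<m))
    u<n : u ℕ.< n
    u<n = ℕ.<-trans u<v v<n
  few : length (arrows (n ∸ 32)) ℕ.≤ edgeCount (spiral n)
  few = ℕ.≤-trans (unique-⊆⇒length-≤ (arrows-unique (n ∸ 32)) contained)
    (ℕ.≤-reflexive (length-map labels (edges (spiral n))))

theorem9 :
    Σ ℚᵘ λ C → Σ ℕ λ N → ∀ (n : ℕ) → N ℕ.≤ n →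
      Σ (Graph n) λ G →
        (1 -Planar) G ×
        HasGirth G 5 ×
        ((+ 2 / 1 ℚ.+ + 1 / 6) ℚ.* (+ n / 1) ℚ.- C ℚ.≤ + edgeCount G / 1)
-- 70 = 420/6, and `five-cycle` needs nine vertices.
theorem9 = + 70 / 1 , 9 , λ n 9≤n → spiral n , 1-planar , girth-5 9≤n , bound n (edgeCount (spiral n)) (edges-many n)
  where
  open ℤSolver
  bound : ∀ n c → 13 ℕ.* n ℕ.≤ 6 ℕ.* c ℕ.+ 420 →
          (+ 2 / 1 ℚ.+ + 1 / 6) ℚ.* (+ n / 1) ℚ.- + 70 / 1 ℚ.≤ + c / 1
  bound n c le = *≤* (subst₂ ℤ._≤_
    (solve 1 (λ n → con (+ 13) :* n :- con (+ 420) :=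
        (con (+ 13) :* n :* con (+ 1) :+ (:- con (+ 70)) :* con (+ 6)) :* con (+ 1)) refl (+ n))
    (solve 1 (λ c → (con (+ 6) :* c :+ con (+ 420)) :- con (+ 420) := c :* con (+ 6)) refl (+ c))
    (ℤ.+-monoˡ-≤ (ℤ.- + 420) (subst₂ ℤ._≤_ (ℤ.pos-* 13 n) (cong (ℤ._+ + 420) (ℤ.pos-* 6 c)) (ℤ.+≤+ le))))
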